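{- Let $H = \overline{P_5}$ be the house. Then $rb(K_n, H) = \Theta(n^{3/2})$.
   Context: The house $H$ is the complement of the path $P_5$ on five vertices (a $5$-cycle with one chord). For a graph $F$ and an integer $n$, the rainbow number $rb(K_n,F)$ is the minimum number $m$ such that every edge-colouring of $K_n$ using at least $m$ colours contains a rainbow copy of $F$ (a subgraph isomorphic to $F$ whose edges all have distinct colours). The asymptotics are as $n \to \infty$. -}

module Defs where

open import Data.Nat using (ℕ; suc; _+_; _*_; _^_; _≤_)
open import Data.Fin using (Fin; toℕ)
open import Data.Product using (Σ; _×_; proj₁; proj₂)
open import Data.Sum using (_⊎_)
open import Relation.Binary.PropositionalEquality using (_≡_; _≢_)
open import Relation.Nullary using (¬_)
open import Function.Definitions using (Injective)

Graph : ℕ → Set₁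
Graph k = Fin k → Fin k → Set

P5 : Graph 5
P5 u v = (suc (toℕ u) ≡ toℕ v) ⊎ (suc (toℕ v) ≡ toℕ u)

House : Graph 5
House u v = (u ≢ v) × ¬ P5 u v

-- An edge-colouring of K_n: a symmetric colour assignment to pairs of
-- vertices (the values on the diagonal are irrelevant).
record EdgeColouring (n : ℕ) : Set where
  field
    col : Fin n → Fin n → ℕ
    sym : ∀ i j → col i j ≡ col j i
open EdgeColouring public

UsesAtLeast : ∀ {n} → EdgeColouring n → ℕ → Set
UsesAtLeast {n} c m =
  Σ (Fin m → Fin n × Fin n) λ e →
    ((k : Fin m) → proj₁ (e k) ≢ proj₂ (e k)) ×
    Injective _≡_ _≡_ (λ k → col c (proj₁ (e k)) (proj₂ (e k)))

RainbowCopy : ∀ {k n} → Graph k → EdgeColouring n → Set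
RainbowCopy {k} {n} F c =
  Σ (Fin k → Fin n) λ φ →
    Injective _≡_ _≡_ φ ×
    (∀ u v u' v' → F u v → F u' v' →
       col c (φ u) (φ v) ≡ col c (φ u') (φ v') →
       (u ≡ u' × v ≡ v') ⊎ (u ≡ v' × v ≡ u'))

Forces : ∀ {k} → Graph k → ℕ → ℕ → Set
Forces F n m = (c : EdgeColouring n) → UsesAtLeast c m → RainbowCopy F c

IsRainbowNumber : ∀ {k} → Graph k → ℕ → ℕ → Set
IsRainbowNumber F n r = Forces F n r × (∀ m → Forces F n m → r ≤ m)

{-# OPTIONS --safe #-}
-- Upper bound. Keep one edge (u , w) of each colour, as a 0/1 matrix. If two rows x, y share four columns b₀, …, b₃,
-- then avoiding the houses on these six vertices forces the colour of b₀b₁ to be that of xb₀ or yb₀, and also that of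
-- xb₁ or yb₁, which is absurd. So two rows share at most three columns, and counting as in the Kővári–Sós–Turán
-- theorem gives m² ≤ 4n³ for the number m of colours.
--
-- Lower bound. Colour the incidence graph of points and lines y = mx + b over ℤ/p injectively and all other pairs with
-- one further colour. A rainbow house has at most one edge outside the graph, so it leaves an odd cycle or a square,
-- while the graph is bipartite without squares. A prime p of order √n comes from Chebyshev's argument: if no prime lies
-- in (a, M²], then every k ≤ M² divides primorial a · (M !)², and hence so does C(2m, m) for 2m < M², which is too large.
--
-- The rainbow number exists constructively because only finitely many colourings matter up to renaming colours.
module Submission where

open import Defs renaming (sym to col-sym)
open import Data.Bool using (Bool; true; false; not)
open import Data.Empty using (⊥)
open import Data.Fin using (Fin; zero; suc; toℕ; fromℕ<; combine; remQuot; finToFun; funToFin; splitAt; join; inject≤; _↑ˡ_; _↑ʳ_)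
open import Data.Fin.Patterns
import Data.Fin.Properties as Fin
open import Data.List.Base using ([]; _∷_)
open import Data.List.Relation.Unary.All using (All; []; _∷_)
open import Data.Nat
open import Data.Nat.Combinatorics using (_C_; nCk+nC[k+1]≡[n+1]C[k+1])
open import Data.Nat.Divisibility
open import Data.Nat.DivMod
open import Data.Nat.ListAction using (product)
open import Data.Nat.Primality
open import Data.Nat.Primality.Factorisation using (factorise; PrimeFactorisation)
open import Data.Nat.Properties
open import Data.Nat.Tactic.RingSolver using (solve-∀)
open import Data.Product
open import Data.Product.Properties using (≡-dec)
open import Data.Sum as Sum using (_⊎_; inj₁; inj₂; [_,_]′)
open import Data.Sum.Properties using (inj₁-injective; inj₂-injective)
open import Data.Vec using ([]; _∷_; lookup)
open import Data.Vec.Relation.Unary.All using ([]; _∷_)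
open import Data.Vec.Relation.Unary.AllPairs using ([]; _∷_)
open import Data.Vec.Relation.Unary.Unique.Propositional.Properties using (lookup-injective)
open import Algebra.Properties.Semiring.Sum +-*-semiring
open import Function using (_∘_)
open import Function.Definitions using (Injective)
open import Relation.Binary.Definitions using (DecidableEquality)
open import Relation.Binary.PropositionalEquality
open import Relation.Nullary using (¬_; Dec; yes; no; contradiction)
open import Relation.Nullary.Decidable using (_×-dec_; _⊎-dec_; _→-dec_; ¬?; map′; decidable-stable; True; False; toWitness; toWitnessFalse)
open import Relation.Unary using (Decidable)

-- Binomial coefficients and primes

[1+k]*[1+n]C[1+k]≡[1+n]*nCk : ∀ n k → suc k * (suc n C suc k) ≡ suc n * (n C k)
[1+k]*[1+n]C[1+k]≡[1+n]*nCk zero zero = refl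
[1+k]*[1+n]C[1+k]≡[1+n]*nCk zero (suc k) = *-zeroʳ (2 + k)
[1+k]*[1+n]C[1+k]≡[1+n]*nCk (suc n) zero = begin
  1 * ((2 + n) C 1)                    ≡⟨ *-identityˡ _ ⟩
  (2 + n) C 1                        ≡⟨ nCk+nC[k+1]≡[n+1]C[k+1] (suc n) 0 ⟨
  1 + (suc n C 1)                    ≡⟨ cong suc (*-identityˡ _) ⟨
  1 + 1 * (suc n C 1)                ≡⟨ cong suc ([1+k]*[1+n]C[1+k]≡[1+n]*nCk n 0) ⟩
  (2 + n) * 1 ∎
  where open ≡-Reasoning
[1+k]*[1+n]C[1+k]≡[1+n]*nCk (suc n) (suc k) = begin
  (2 + k) * ((2 + n) C (2 + k))        ≡⟨ cong ((2 + k) *_) (nCk+nC[k+1]≡[n+1]C[k+1] (suc n) (suc k)) ⟨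
  (2 + k) * (x + (suc n C (2 + k)))  ≡⟨ *-distribˡ-+ (2 + k) x _ ⟩
  (x + suc k * x) + (2 + k) * (suc n C (2 + k))
    ≡⟨ cong₂ (λ a b → (x + a) + b) ([1+k]*[1+n]C[1+k]≡[1+n]*nCk n k) ([1+k]*[1+n]C[1+k]≡[1+n]*nCk n (suc k)) ⟩
  (x + suc n * (n C k)) + suc n * (n C suc k)  ≡⟨ +-assoc x _ _ ⟩
  x + (suc n * (n C k) + suc n * (n C suc k))  ≡⟨ cong (x +_) (*-distribˡ-+ (suc n) (n C k) _) ⟨
  x + suc n * (n C k + n C suc k)    ≡⟨ cong (λ a → x + suc n * a) (nCk+nC[k+1]≡[n+1]C[k+1] n k) ⟩
  (2 + n) * x ∎
  where
  open ≡-Reasoning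
  x = suc n C suc k

-- Pascal's rule and the absorption identity above, arranged without subtraction; it clears the
-- denominators in the harmonic triangle below.
[1+k]*nC[1+k]+k*nCk≡n*nCk : ∀ n k → suc k * (n C suc k) + k * (n C k) ≡ n * (n C k)
[1+k]*nC[1+k]+k*nCk≡n*nCk n k = +-cancelˡ-≡ x _ _ (begin
  x + (suc k * y + k * x)  ≡⟨ lemma x y k ⟩
  suc k * (x + y)          ≡⟨ cong (suc k *_) (nCk+nC[k+1]≡[n+1]C[k+1] n k) ⟩
  suc k * (suc n C suc k)  ≡⟨ [1+k]*[1+n]C[1+k]≡[1+n]*nCk n k ⟩
  suc n * x ∎)
  where
  open ≡-Reasoning
  x = n C k
  y = n C suc k
  lemma : ∀ x y k → x + (suc k * y + k * x) ≡ suc k * (x + y)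
  lemma = solve-∀

nCk≤[1+n]Ck : ∀ n k → n C k ≤ suc n C k
nCk≤[1+n]Ck n zero    = ≤-refl
nCk≤[1+n]Ck n (suc k) = subst (n C suc k ≤_) (nCk+nC[k+1]≡[n+1]C[k+1] n k) (m≤n+m _ (n C k))

nCk≤2^n : ∀ n k → n C k ≤ 2 ^ n
nCk≤2^n zero    zero    = ≤-refl
nCk≤2^n zero    (suc k) = z≤n
nCk≤2^n (suc n) zero    = m^n>0 2 (suc n)
nCk≤2^n (suc n) (suc k) = begin
  suc n C suc k        ≡⟨ nCk+nC[k+1]≡[n+1]C[k+1] n k ⟨
  n C k + n C suc k    ≤⟨ +-mono-≤ (nCk≤2^n n k) (nCk≤2^n n (suc k)) ⟩
  2 ^ n + 2 ^ n        ≡⟨ cong (2 ^ n +_) (+-identityʳ _) ⟨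
  2 ^ suc n            ∎
  where open ≤-Reasoning

-- By Pascal's rule the next central coefficient is a sum of two entries, each at least C(2n, n).
2^n≤[2n]Cn : ∀ n → 2 ^ n ≤ (n + n) C n
2^n≤[2n]Cn zero = ≤-refl
2^n≤[2n]Cn (suc n) = begin
  2 ^ n + (2 ^ n + 0)                      ≡⟨ cong (2 ^ n +_) (+-identityʳ _) ⟩
  2 ^ n + 2 ^ n                            ≤⟨ +-mono-≤ ih ih ⟩
  x + x                                    ≤⟨ +-mono-≤ (nCk≤[1+n]Ck (n + n) n) x≤ ⟩
  (suc (n + n)) C n + (suc (n + n)) C suc n ≡⟨ nCk+nC[k+1]≡[n+1]C[k+1] (suc (n + n)) n ⟩
  (suc (suc (n + n))) C suc n              ≡⟨ cong (λ a → suc a C suc n) (+-suc n n) ⟨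
  (suc n + suc n) C suc n                  ∎
  where
  open ≤-Reasoning
  x = (n + n) C n
  ih = 2^n≤[2n]Cn n
  x≤ : x ≤ suc (n + n) C suc n
  x≤ = subst (x ≤_) (nCk+nC[k+1]≡[n+1]C[k+1] (n + n) n) (m≤m+n x _)

-- The recurrence 1/((n+2) C(n+1,k+1)) = 1/((n+1) C(n,k)) − 1/((n+2) C(n+1,k))
-- of Leibniz's harmonic triangle, multiplied by D.
[1+n]*nCk∣D : ∀ {N D} → (∀ j → 0 < j → j ≤ N → j ∣ D) →
              ∀ n k → k ≤ n → n < N → suc n * (n C k) ∣ D
[1+n]*nCk∣D {D = D} h n zero k≤n n<N = subst (_∣ D) (sym (*-identityʳ (suc n))) (h (suc n) z<s n<N)
[1+n]*nCk∣D {N} {D} h (suc n) (suc k) (s≤s k≤n) n<N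
  with [1+n]*nCk∣D h n k k≤n (<-trans (n<1+n n) n<N) | [1+n]*nCk∣D h (suc n) k (m≤n⇒m≤1+n k≤n) n<N
... | divides X D≡XG | divides Y D≡YF = ∣m+n∣m⇒∣n (divides X E*X≡) (m∣m*n Y)
  where
  open ≡-Reasoning
  c = n C k
  e = suc n C suc k
  f = suc n C k
  E = (2 + n) * e
  -- With `D = X (n+1) C(n,k) = Y (n+2) C(n+1,k)`, the recurrence says `D / E = X − Y`. The form
  -- `E * Y + D ≡ X * E` avoids subtraction, and the factor `suc k` lets absorption relate the
  -- binomials.
  key : suc k * (E * Y + D) ≡ suc k * (X * E)
  key = begin
    suc k * (E * Y + D)                                  ≡⟨ l₁ n k e Y D ⟩
    (2 + n) * Y * (suc k * e) + k * D + D                ≡⟨ cong (λ a → (2 + n) * Y * (suc k * e) + k * a + D) D≡YF ⟩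
    (2 + n) * Y * (suc k * e) + k * (Y * ((2 + n) * f)) + D ≡⟨ cong (_+ D) (l₂ n k Y e f) ⟩
    (2 + n) * Y * (suc k * e + k * f) + D                ≡⟨ cong (λ a → (2 + n) * Y * a + D) ([1+k]*nC[1+k]+k*nCk≡n*nCk (suc n) k) ⟩
    (2 + n) * Y * (suc n * f) + D                        ≡⟨ cong (_+ D) (l₃ n Y f) ⟩
    suc n * (Y * ((2 + n) * f)) + D                      ≡⟨ cong (λ a → suc n * a + D) D≡YF ⟨
    suc n * D + D                                        ≡⟨ +-comm (suc n * D) D ⟩
    (2 + n) * D                                          ≡⟨ cong ((2 + n) *_) D≡XG ⟩
    (2 + n) * (X * (suc n * c))                          ≡⟨ cong (λ a → (2 + n) * (X * a)) ([1+k]*[1+n]C[1+k]≡[1+n]*nCk n k) ⟨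
    (2 + n) * (X * (suc k * e))                          ≡⟨ l₄ n X k e ⟩
    suc k * (X * E)                                      ∎
    where
    l₁ : ∀ n k e Y D → suc k * ((2 + n) * e * Y + D) ≡ (2 + n) * Y * (suc k * e) + k * D + D
    l₁ = solve-∀
    l₂ : ∀ n k Y e f → (2 + n) * Y * (suc k * e) + k * (Y * ((2 + n) * f)) ≡ (2 + n) * Y * (suc k * e + k * f)
    l₂ = solve-∀
    l₃ : ∀ n Y f → (2 + n) * Y * (suc n * f) ≡ suc n * (Y * ((2 + n) * f))
    l₃ = solve-∀
    l₄ : ∀ n X k e → (2 + n) * (X * (suc k * e)) ≡ suc k * (X * ((2 + n) * e))
    l₄ = solve-∀
  E*X≡ : E * Y + D ≡ X * E
  E*X≡ = *-cancelˡ-≡ _ _ (suc k) key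

-- Induction on `a` through absorption: `p` cannot divide the smaller number `suc a`, and it divides
-- the other side either by induction or because `suc (a + b)` is `p` itself.
prime∣C : ∀ {p} → Prime p → ∀ a b → a < p → b < p → p ≤ a + b → p ∣ (a + b) C a
prime∣C pp zero b a<p b<p p≤ = contradiction b<p (≤⇒≯ p≤)
prime∣C {p} pp (suc a) b a<p b<p p≤ =
  [ (λ p∣1+a → contradiction (∣⇒≤ p∣1+a) (<⇒≱ a<p)) , (λ d → d) ]′
    (euclidsLemma (suc a) _ pp
      (subst (p ∣_) (sym ([1+k]*[1+n]C[1+k]≡[1+n]*nCk (a + b) a)) p∣rhs))
  where
  p∣rhs : p ∣ suc (a + b) * ((a + b) C a)
  p∣rhs with m≤n⇒m<n∨m≡n p≤
  ... | inj₁ (s≤s p≤a+b) = ∣n⇒∣m*n (suc (a + b)) (prime∣C pp a b (<-trans (n<1+n a) a<p) b<p p≤a+b)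
  ... | inj₂ refl        = m∣m*n _

-- Growth of the primorial

primorial : ℕ → ℕ
primorial zero = 1
primorial (suc n) with prime? (suc n)
... | yes _ = suc n * primorial n
... | no  _ = primorial n

primorial>0 : ∀ n → 0 < primorial n
primorial>0 zero = z<s
primorial>0 (suc n) with prime? (suc n)
... | yes _ = *-mono-< (z<s {n}) (primorial>0 n)
... | no  _ = primorial>0 n

prime∣primorial⇒≤ : ∀ {p} n → Prime p → p ∣ primorial n → p ≤ n
prime∣primorial⇒≤ zero pp p∣1 = contradiction (subst Prime (∣1⇒≡1 p∣1) pp) ¬prime[1]
prime∣primorial⇒≤ (suc n) pp p∣P with prime? (suc n)
... | no  _ = m≤n⇒m≤1+n (prime∣primorial⇒≤ n pp p∣P)
... | yes _ = [ ∣⇒≤ , (λ p∣P → m≤n⇒m≤1+n (prime∣primorial⇒≤ n pp p∣P)) ]′ (euclidsLemma (suc n) _ pp p∣P)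

≤⇒prime∣primorial : ∀ {p} n → Prime p → p ≤ n → p ∣ primorial n
≤⇒prime∣primorial zero pp z≤n = contradiction pp ¬prime[0]
≤⇒prime∣primorial (suc n) pp p≤ with prime? (suc n) | m≤n⇒m<n∨m≡n p≤
... | yes _  | inj₁ (s≤s p≤n) = ∣n⇒∣m*n (suc n) (≤⇒prime∣primorial n pp p≤n)
... | yes _  | inj₂ refl      = m∣m*n _
... | no _   | inj₁ (s≤s p≤n) = ≤⇒prime∣primorial n pp p≤n
... | no ¬pp | inj₂ refl      = contradiction pp ¬pp

prime∣∧∤∧∣⇒*∣ : ∀ {p m o} → Prime p → p ∣ o → p ∤ m → m ∣ o → p * m ∣ o
prime∣∧∤∧∣⇒*∣ {p} {m} pp p∣o p∤m (divides q refl) =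
  [ *-monoˡ-∣ m , (λ p∣m → contradiction p∣m p∤m) ]′ (euclidsLemma q m pp p∣o)

-- The primes in `(a, a + j]` are multiplied on one at a time; each is coprime to the primorial
-- before it, whose prime factors are all smaller.
primorial[a+j]∣ : ∀ {X} a j → (∀ p → Prime p → a < p → p ≤ a + j → p ∣ X) → primorial (a + j) ∣ primorial a * X
primorial[a+j]∣ {X} a zero h = subst (λ b → primorial b ∣ primorial a * X) (sym (+-identityʳ a)) (m∣m*n X)
primorial[a+j]∣ {X} a (suc j) h = subst (λ b → primorial b ∣ primorial a * X) (sym (+-suc a j)) step
  where
  ih : primorial (a + j) ∣ primorial a * X
  ih = primorial[a+j]∣ a j (λ p pp a<p p≤ → h p pp a<p (≤-trans p≤ (+-monoʳ-≤ a (n≤1+n j))))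
  step : primorial (suc (a + j)) ∣ primorial a * X
  step with prime? (suc (a + j))
  ... | no _   = ih
  ... | yes pp = prime∣∧∤∧∣⇒*∣ pp
    (∣n⇒∣m*n (primorial a) (h _ pp (s≤s (m≤m+n a j)) (≤-reflexive (sym (+-suc a j)))))
    (λ p∣P → 1+n≰n (prime∣primorial⇒≤ (a + j) pp p∣P)) ih

-- Every prime in `(n, 2n]` divides C(2n, n), which is at most `2 ^ (n + n)`.
primorial[2n]≤ : ∀ n → primorial (n + n) ≤ primorial n * 2 ^ (n + n)
primorial[2n]≤ zero = s≤s z≤n
primorial[2n]≤ n@(suc _) = ≤-trans (∣⇒≤ (primorial[a+j]∣ n n p∣C)) (*-monoʳ-≤ (primorial n) (nCk≤2^n (n + n) n))
  where
  p∣C : ∀ p → Prime p → n < p → p ≤ n + n → p ∣ (n + n) C n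
  p∣C p pp n<p p≤ = prime∣C pp n n n<p n<p p≤
  instance
    P≢0 : NonZero (primorial n)
    P≢0 = >-nonZero (primorial>0 n)
    C≢0 : NonZero ((n + n) C n)
    C≢0 = >-nonZero (≤-trans (m^n>0 2 n) (2^n≤[2n]Cn n))
    PC≢0 : NonZero (primorial n * ((n + n) C n))
    PC≢0 = m*n≢0 (primorial n) ((n + n) C n)

-- Iterated doubling: the exponents `2n` and `n + n` add up to `2 (2n)`. On powers of two no
-- rounding occurs.
primorial[2^k]≤ : ∀ k → primorial (2 ^ k) ≤ 2 ^ (2 * 2 ^ k)
primorial[2^k]≤ zero = s≤s z≤n
primorial[2^k]≤ (suc k) = begin
  primorial (2 * n)              ≡⟨ cong primorial 2n≡ ⟩
  primorial (n + n)              ≤⟨ primorial[2n]≤ n ⟩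
  primorial n * 2 ^ (n + n)      ≤⟨ *-monoˡ-≤ _ (primorial[2^k]≤ k) ⟩
  2 ^ (2 * n) * 2 ^ (n + n)      ≡⟨ ^-distribˡ-+-* 2 (2 * n) (n + n) ⟨
  2 ^ (2 * n + (n + n))          ≡⟨ cong (2 ^_) (lemma n) ⟩
  2 ^ (2 * (2 * n))              ∎
  where
  open ≤-Reasoning
  n = 2 ^ k
  2n≡ : 2 * n ≡ n + n
  2n≡ = cong (n +_) (+-identityʳ n)
  lemma : ∀ n → 2 * n + (n + n) ≡ 2 * (2 * n)
  lemma = solve-∀

-- A prime between h² and 16h²

n!≤n^n : ∀ n → n ! ≤ n ^ n
n!≤n^n zero = ≤-refl
n!≤n^n (suc n) = *-monoʳ-≤ (suc n) (≤-trans (n!≤n^n n) (^-monoˡ-≤ n (n≤1+n n)))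

∣! : ∀ {t} n → 0 < t → t ≤ n → t ∣ n !
∣! {suc t} n _ t≤n = ∣-trans (m∣m*n (t !)) (m≤n⇒m!∣n! t≤n)

-- Square-free decomposition, one prime at a time: a prime new to `s` joins `s`, while a repeated
-- one is removed from `s` and moved into `t`.
product≡s*t² : ∀ n ps → All Prime ps → All (_≤ n) ps →
               ∃₂ λ s t → product ps ≡ s * (t * t) × s ∣ primorial n
product≡s*t² n [] [] [] = 1 , 1 , refl , 1∣ _
product≡s*t² n (p ∷ ps) (pp ∷ pps) (p≤n ∷ ps≤n) with product≡s*t² n ps pps ps≤n
... | s , t , eq , s∣P with p ∣? s
...   | no p∤s = p * s , t , trans (cong (p *_) eq) (sym (*-assoc p s _)) ,
                 prime∣∧∤∧∣⇒*∣ pp (≤⇒prime∣primorial n pp p≤n) p∤s s∣P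
...   | yes (divides q refl) = q , p * t , trans (cong (p *_) eq) (lemma p q t) , ∣-trans (m∣m*n p) s∣P
  where
  lemma : ∀ p q t → p * (q * p * (t * t)) ≡ q * (p * t * (p * t))
  lemma = solve-∀

m*m≤n*n⇒m≤n : ∀ {m n} → m * m ≤ n * n → m ≤ n
m*m≤n*n⇒m≤n m²≤n² = ≮⇒≥ (λ n<m → <⇒≱ (*-mono-< n<m n<m) m²≤n²)

-- The numerical estimate behind `exponents` in `prime-between`. In the form `8 (2 + i) < 5 · 2 ^ i`
-- it is an equality at `i = 3`, so the induction starts at `i = 4`.
8*[6+j]<5*2^[4+j] : ∀ j → 8 * (6 + j) < 5 * 2 ^ (4 + j)
8*[6+j]<5*2^[4+j] zero = toWitness {a? = 49 ≤? 80} _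
8*[6+j]<5*2^[4+j] (suc j) = begin-strict
  8 * (7 + j)                ≡⟨ lemma j ⟩
  8 * (6 + j) + 8            <⟨ +-mono-<-≤ (8*[6+j]<5*2^[4+j] j) 8≤ ⟩
  x + x                      ≡⟨ lemma' (2 ^ (4 + j)) ⟩
  5 * 2 ^ (5 + j)            ∎
  where
  open ≤-Reasoning
  x = 5 * 2 ^ (4 + j)
  lemma : ∀ j → 8 * (7 + j) ≡ 8 * (6 + j) + 8
  lemma = solve-∀
  lemma' : ∀ y → 5 * y + 5 * y ≡ 5 * (2 * y)
  lemma' = solve-∀
  8≤ : 8 ≤ x
  8≤ = ≤-trans (≤-trans (m≤m*n 8 (6 + j)) (n≤1+n _)) (8*[6+j]<5*2^[4+j] j)

-- If no prime lies in (n, M²], then every k ≤ M² is s t² with s ∣ primorial n and t ∣ M !.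
k∣primorial*M!² : ∀ n M → (∀ p → Prime p → p ≤ M * M → p ≤ n) →
                  ∀ k → 0 < k → k ≤ M * M → k ∣ primorial n * (M ! * M !)
k∣primorial*M!² n M h k@(suc _) _ k≤ = goal
  where
  open PrimeFactorisation (factorise k)
  bound : ∀ ps → All Prime ps → product ps ∣ k → All (_≤ n) ps
  bound [] _ _ = []
  bound (p ∷ ps) (pp ∷ pps) pps∣k =
    h p pp (≤-trans (∣⇒≤ (∣-trans (m∣m*n (product ps)) pps∣k)) k≤) ∷
    bound ps pps (∣-trans (n∣m*n p) pps∣k)
  goal : k ∣ primorial n * (M ! * M !)
  goal with product≡s*t² n factors factorsPrime (bound factors factorsPrime (∣-reflexive (sym isFactorisation)))
  ... | s , zero , eq , _ = contradiction (trans isFactorisation (trans eq (*-zeroʳ s))) λ ()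
  ... | s , t@(suc _) , eq , s∣P = subst (_∣ primorial n * (M ! * M !)) (sym k≡)
    (*-pres-∣ s∣P (*-pres-∣ t∣M! t∣M!))
    where
    k≡ : k ≡ s * (t * t)
    k≡ = trans isFactorisation eq
    t∣M! : t ∣ M !
    t∣M! = ∣! M z<s (m*m≤n*n⇒m≤n (≤-trans (≤-trans (m≤n*m (t * t) s {{m*n≢0⇒m≢0 s {t * t} {{≢-nonZero λ s*t²≡0 → contradiction (trans k≡ s*t²≡0) λ ()}}}}) (≤-reflexive (sym k≡))) k≤))

-- Put `h = 2 ^ (4 + j)`, so that `n = h²` and `M = 4h`. If the interval held no prime, C(2m, m)
-- would divide `D`. But C(2m, m) is at least `2 ^ m`, while `D` is at most 2 to the power
-- `2h² + 8 (6 + j) h`, which is less than `m = 7h²`.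
prime-between : ∀ j → ∃ λ p → Prime p × 2 ^ (2 * (4 + j)) < p × p ≤ 2 ^ (6 + j) * 2 ^ (6 + j)
prime-between j with anyUpTo? (λ p → prime? p ×-dec (n <? p)) (suc (M * M))
  where n = 2 ^ (2 * (4 + j))
        M = 2 ^ (6 + j)
... | yes (p , s≤s p≤ , pp , n<p) = p , pp , n<p , p≤
... | no ¬p = contradiction 2^≤2^ (<⇒≱ (^-monoʳ-< 2 (s≤s (s≤s z≤n)) exponents))
  where
  open ≤-Reasoning
  i = 4 + j
  h = 2 ^ i
  n = 2 ^ (2 * i)
  M = 2 ^ (2 + i)
  n≡h*h : n ≡ h * h
  n≡h*h = trans (cong (λ a → 2 ^ (i + a)) (+-identityʳ i)) (^-distribˡ-+-* 2 i i)
  h>0 : 0 < h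
  h>0 = m^n>0 2 i
  D = primorial n * (M ! * M !)
  D≢0 : NonZero D
  D≢0 = m*n≢0 (primorial n) (M ! * M !) {{>-nonZero (primorial>0 n)}} {{m*n≢0 _ _ {{M !≢0}} {{M !≢0}}}}
  k∣D : ∀ k → 0 < k → k ≤ M * M → k ∣ D
  k∣D = k∣primorial*M!² n M (λ p pp p≤ → ≮⇒≥ (λ n<p → ¬p (p , s≤s p≤ , pp , n<p)))
  -- The largest multiple of `h²` with `2m < M² = 16h²`.
  m = 7 * (h * h)
  2m<M² : m + m < M * M
  2m<M² = begin-strict
    m + m               <⟨ m<m+n (m + m) (*-mono-< (*-mono-< (z<s {1}) h>0) h>0) ⟩
    m + m + 2 * h * h   ≡⟨ lemma h ⟩
    M * M               ∎
    where
    lemma : ∀ h → 7 * (h * h) + 7 * (h * h) + 2 * h * h ≡ 2 * (2 * h) * (2 * (2 * h))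
    lemma = solve-∀
  M!≤ : M ! ≤ 2 ^ ((2 + i) * M)
  M!≤ = ≤-trans (n!≤n^n M) (≤-reflexive (^-*-assoc 2 (2 + i) M))
  2^≤2^ : 2 ^ m ≤ 2 ^ (2 * n + ((2 + i) * M + (2 + i) * M))
  2^≤2^ = begin
    2 ^ m                    ≤⟨ 2^n≤[2n]Cn m ⟩
    (m + m) C m              ≤⟨ ∣⇒≤ {{D≢0}} (∣-trans (n∣m*n (suc (m + m))) ([1+n]*nCk∣D k∣D (m + m) m (m≤m+n m m) 2m<M²)) ⟩
    D                        ≤⟨ *-mono-≤ (primorial[2^k]≤ (2 * i)) (*-mono-≤ M!≤ M!≤) ⟩
    2 ^ (2 * n) * (2 ^ ((2 + i) * M) * 2 ^ ((2 + i) * M)) ≡⟨ cong (2 ^ (2 * n) *_) (^-distribˡ-+-* 2 ((2 + i) * M) _) ⟨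
    2 ^ (2 * n) * 2 ^ ((2 + i) * M + (2 + i) * M)         ≡⟨ ^-distribˡ-+-* 2 (2 * n) _ ⟨
    2 ^ (2 * n + ((2 + i) * M + (2 + i) * M)) ∎
  exponents : 2 * n + ((2 + i) * M + (2 + i) * M) < m
  exponents = begin-strict
    2 * n + ((2 + i) * M + (2 + i) * M)  ≡⟨ cong (λ a → 2 * a + ((2 + i) * M + (2 + i) * M)) n≡h*h ⟩
    2 * (h * h) + ((2 + i) * M + (2 + i) * M) ≡⟨ lemma h (2 + i) ⟩
    2 * (h * h) + 8 * (2 + i) * h        <⟨ +-monoʳ-< (2 * (h * h)) (*-monoˡ-< h {{>-nonZero h>0}} (8*[6+j]<5*2^[4+j] j)) ⟩
    2 * (h * h) + 5 * h * h              ≡⟨ lemma' h ⟩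
    7 * (h * h)                          ∎
    where
    lemma : ∀ h a → 2 * (h * h) + (a * (2 * (2 * h)) + a * (2 * (2 * h))) ≡ 2 * (h * h) + 8 * a * h
    lemma = solve-∀
    lemma' : ∀ h → 2 * (h * h) + 5 * h * h ≡ 7 * (h * h)
    lemma' = solve-∀

-- Rows with common columns

sum-mono-≤ : ∀ {n} {f g : Fin n → ℕ} → (∀ i → f i ≤ g i) → sum f ≤ sum g
sum-mono-≤ {zero}  f≤g = z≤n
sum-mono-≤ {suc n} f≤g = +-mono-≤ (f≤g zero) (sum-mono-≤ (f≤g ∘ suc))

sum≤n*b : ∀ {n} {f : Fin n → ℕ} b → (∀ i → f i ≤ b) → sum f ≤ n * b
sum≤n*b {zero}  b f≤b = z≤n
sum≤n*b {suc n} b f≤b = +-mono-≤ (f≤b zero) (sum≤n*b b (f≤b ∘ suc))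

sum-const-1 : ∀ n → ∑[ i < n ] 1 ≡ n
sum-const-1 zero = refl
sum-const-1 (suc n) = cong suc (sum-const-1 n)

f[i]≤sum : ∀ {n} (f : Fin n → ℕ) i → f i ≤ sum f
f[i]≤sum f zero    = m≤m+n _ _
f[i]≤sum f (suc i) = ≤-trans (f[i]≤sum (f ∘ suc) i) (m≤n+m _ (f zero))

2xy≤x²+y² : ∀ x y → 2 * (x * y) ≤ x * x + y * y
2xy≤x²+y² x y = [ ordered x y , (λ y≤x → subst₂ _≤_ (cong (2 *_) (*-comm y x)) (+-comm (y * y) _) (ordered y x y≤x)) ]′ (≤-total x y)
  where
  ordered : ∀ x y → x ≤ y → 2 * (x * y) ≤ x * x + y * y
  ordered x y x≤y with d , refl ← m≤n⇒∃[o]m+o≡n x≤y =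
    ≤-trans (m≤m+n _ (d * d)) (≤-reflexive (lemma x d))
    where
    lemma : ∀ x d → 2 * (x * (x + d)) + d * d ≡ x * x + (x + d) * (x + d)
    lemma = solve-∀

-- Handles the cross terms in the inductive step of `cauchy-schwarz`.
2x∑f≤nx²+∑f² : ∀ {n} x (f : Fin n → ℕ) → 2 * (x * sum f) ≤ n * (x * x) + ∑[ i < n ] (f i * f i)
2x∑f≤nx²+∑f² {zero} x f = ≤-reflexive (cong (2 *_) (*-zeroʳ x))
2x∑f≤nx²+∑f² {suc n} x f = begin
  2 * (x * (y + s))                      ≡⟨ l₁ x y s ⟩
  2 * (x * y) + 2 * (x * s)              ≤⟨ +-mono-≤ (2xy≤x²+y² x y) (2x∑f≤nx²+∑f² x (f ∘ suc)) ⟩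
  x * x + y * y + (n * (x * x) + q)      ≡⟨ l₂ x y n q ⟩
  suc n * (x * x) + (y * y + q)          ∎
  where
  open ≤-Reasoning
  y = f zero
  s = sum (f ∘ suc)
  q = ∑[ i < n ] (f (suc i) * f (suc i))
  l₁ : ∀ x y s → 2 * (x * (y + s)) ≡ 2 * (x * y) + 2 * (x * s)
  l₁ = solve-∀
  l₂ : ∀ x y n q → x * x + y * y + (n * (x * x) + q) ≡ suc n * (x * x) + (y * y + q)
  l₂ = solve-∀

cauchy-schwarz : ∀ {n} (f : Fin n → ℕ) → sum f * sum f ≤ n * ∑[ i < n ] (f i * f i)
cauchy-schwarz {zero} f = z≤n
cauchy-schwarz {suc n} f = begin
  (x + s) * (x + s)                            ≡⟨ l₁ x s ⟩
  x * x + 2 * (x * s) + s * s                  ≤⟨ +-mono-≤ (+-monoʳ-≤ (x * x) (2x∑f≤nx²+∑f² x (f ∘ suc))) (cauchy-schwarz (f ∘ suc)) ⟩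
  x * x + (n * (x * x) + q) + n * q            ≡⟨ l₂ x n q ⟩
  suc n * (x * x + q)                          ∎
  where
  open ≤-Reasoning
  x = f zero
  s = sum (f ∘ suc)
  q = ∑[ i < n ] (f (suc i) * f (suc i))
  l₁ : ∀ x s → (x + s) * (x + s) ≡ x * x + 2 * (x * s) + s * s
  l₁ = solve-∀
  l₂ : ∀ x n q → x * x + (n * (x * x) + q) + n * q ≡ suc n * (x * x + q)
  l₂ = solve-∀

χ : ∀ {P : Set} → Dec P → ℕ
χ (yes _) = 1
χ (no  _) = 0

χ≤1 : ∀ {P : Set} (P? : Dec P) → χ P? ≤ 1
χ≤1 (yes _) = ≤-refl
χ≤1 (no _)  = z≤n

1≤χ : ∀ {P : Set} (P? : Dec P) → P → 1 ≤ χ P?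
1≤χ (yes _) p = ≤-refl
1≤χ (no ¬p) p = contradiction p ¬p

χ≤0 : ∀ {P : Set} (P? : Dec P) → ¬ P → χ P? ≤ 0
χ≤0 (yes p) ¬p = contradiction p ¬p
χ≤0 (no _)  ¬p = z≤n

χ-× : ∀ {P Q : Set} (P? : Dec P) (Q? : Dec Q) → χ P? * χ Q? ≡ χ (P? ×-dec Q?)
χ-× (yes _) (yes _) = refl
χ-× (yes _) (no _)  = refl
χ-× (no _)  _       = refl

-- Turns a lower bound on a count back into distinct elements; four common columns are extracted
-- this way.
distinct-witnesses : ∀ {n} {P : Fin n → Set} (P? : ∀ i → Dec (P i)) t → t ≤ ∑[ i < n ] χ (P? i) →
                     ∃ λ (f : Fin t → Fin n) → Injective _≡_ _≡_ f × (∀ j → P (f j))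
distinct-witnesses P? zero t≤ = (λ ()) , (λ { {()} }) , λ ()
distinct-witnesses {suc n} P? (suc t) t≤ with P? zero | t≤
... | no _  | t≤′ with f , inj , pf ← distinct-witnesses (P? ∘ suc) (suc t) t≤′
  = suc ∘ f , inj ∘ Fin.suc-injective , pf
... | yes p | s≤s t≤′ with f , inj , pf ← distinct-witnesses (P? ∘ suc) t t≤′
  = g , g-inj , λ { zero → p ; (suc j) → pf j }
  where
  g : Fin (suc t) → Fin (suc n)
  g zero = zero
  g (suc j) = suc (f j)
  g-inj : Injective _≡_ _≡_ g
  g-inj {zero}  {zero}  _  = refl
  g-inj {suc i} {suc j} eq = cong suc (inj (Fin.suc-injective eq))

∑χ≤1 : ∀ {n} {P : Fin n → Set} (P? : ∀ i → Dec (P i)) → (∀ {i j} → P i → P j → i ≡ j) → ∑[ i < n ] χ (P? i) ≤ 1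
∑χ≤1 P? unique = ≮⇒≥ λ 2≤ →
  let f , inj , pf = distinct-witnesses P? 2 2≤
  in contradiction (inj (unique (pf 0F) (pf 1F))) λ ()

-- Double counting of triples `(u, v, w)` with both `u` and `v` adjacent to `w`: the squared column
-- degrees `d w` add up to the sum of all codegrees. Cauchy-Schwarz compares the former with
-- `m * m`.
few-common⇒few-edges : ∀ {m n} (e : Fin m → Fin n × Fin n) → Injective _≡_ _≡_ e →
  let adj? = λ u w → Fin.any? λ k → ≡-dec Fin._≟_ Fin._≟_ (e k) (u , w) in
  (∀ u v → u ≢ v → ∑[ w < n ] χ (adj? u w ×-dec adj? v w) ≤ 3) →
  m * m ≤ n * (n * (n * 4))
few-common⇒few-edges {m} {n} e e-inj codeg≤3 = begin
  m * m                                  ≤⟨ *-mono-≤ m≤∑d m≤∑d ⟩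
  sum d * sum d                          ≤⟨ cauchy-schwarz d ⟩
  n * ∑[ w < n ] (d w * d w)             ≡⟨ cong (n *_) ∑d²≡ ⟩
  n * ∑[ u < n ] ∑[ v < n ] codeg u v    ≤⟨ *-monoʳ-≤ n (sum≤n*b (n * 4) row≤) ⟩
  n * (n * (n * 4))                      ∎
  where
  open ≤-Reasoning
  Adj : Fin n → Fin n → Set
  Adj u w = ∃ λ k → e k ≡ (u , w)
  adj? : ∀ u w → Dec (Adj u w)
  adj? u w = Fin.any? λ k → ≡-dec Fin._≟_ Fin._≟_ (e k) (u , w)
  a : Fin n → Fin n → ℕ
  a u w = χ (adj? u w)
  d : Fin n → ℕ
  d w = ∑[ u < n ] a u w
  codeg : Fin n → Fin n → ℕ
  codeg u v = ∑[ w < n ] χ (adj? u w ×-dec adj? v w)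
  δ : Fin m → Fin n → Fin n → ℕ
  δ k u w = χ (≡-dec Fin._≟_ Fin._≟_ (e k) (u , w))
  1≤∑∑δ : ∀ k → 1 ≤ ∑[ u < n ] ∑[ w < n ] δ k u w
  1≤∑∑δ k = begin
    1                            ≤⟨ 1≤χ (≡-dec Fin._≟_ Fin._≟_ (e k) (e k)) refl ⟩
    δ k u w                      ≤⟨ f[i]≤sum (δ k u) w ⟩
    ∑[ w < n ] δ k u w           ≤⟨ f[i]≤sum (λ u → ∑[ w < n ] δ k u w) u ⟩
    ∑[ u < n ] ∑[ w < n ] δ k u w ∎
    where
    u = proj₁ (e k)
    w = proj₂ (e k)
  -- As `e` is injective, at most one index `k` hits a given matrix entry.
  ∑δ≤a : ∀ u w → ∑[ k < m ] δ k u w ≤ a u w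
  ∑δ≤a u w with adj? u w
  ... | yes _    = ∑χ≤1 (λ k → ≡-dec Fin._≟_ Fin._≟_ (e k) (u , w)) (λ p q → e-inj (trans p (sym q)))
  ... | no ¬adj = ≤-trans (sum≤n*b 0 λ k → χ≤0 (≡-dec Fin._≟_ Fin._≟_ (e k) (u , w)) λ p → ¬adj (k , p))
                          (≤-reflexive (*-zeroʳ m))
  m≤∑d : m ≤ sum d
  m≤∑d = begin
    m                                            ≡⟨ sum-const-1 m ⟨
    ∑[ k < m ] 1                                 ≤⟨ sum-mono-≤ 1≤∑∑δ ⟩
    ∑[ k < m ] ∑[ u < n ] ∑[ w < n ] δ k u w     ≡⟨ ∑-comm (λ k u → ∑[ w < n ] δ k u w) ⟩
    ∑[ u < n ] ∑[ k < m ] ∑[ w < n ] δ k u w     ≡⟨ sum-cong-≗ (λ u → ∑-comm (λ k w → δ k u w)) ⟩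
    ∑[ u < n ] ∑[ w < n ] ∑[ k < m ] δ k u w     ≤⟨ sum-mono-≤ (λ u → sum-mono-≤ (∑δ≤a u)) ⟩
    ∑[ u < n ] ∑[ w < n ] a u w                  ≡⟨ ∑-comm a ⟩
    sum d                                        ∎
  d²≡ : ∀ w → d w * d w ≡ ∑[ u < n ] ∑[ v < n ] χ (adj? u w ×-dec adj? v w)
  d²≡ w = begin-equality
    d w * d w                                    ≡⟨ *-distribʳ-sum (d w) (λ u → a u w) ⟩
    ∑[ u < n ] (a u w * d w)                     ≡⟨ sum-cong-≗ (λ u → *-distribˡ-sum (a u w) (λ v → a v w)) ⟩
    ∑[ u < n ] ∑[ v < n ] (a u w * a v w)        ≡⟨ sum-cong-≗ (λ u → sum-cong-≗ (λ v → χ-× (adj? u w) (adj? v w))) ⟩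
    ∑[ u < n ] ∑[ v < n ] χ (adj? u w ×-dec adj? v w) ∎
  ∑d²≡ : ∑[ w < n ] (d w * d w) ≡ ∑[ u < n ] ∑[ v < n ] codeg u v
  ∑d²≡ = begin-equality
    ∑[ w < n ] (d w * d w)                       ≡⟨ sum-cong-≗ d²≡ ⟩
    ∑[ w < n ] ∑[ u < n ] ∑[ v < n ] χ (adj? u w ×-dec adj? v w)
      ≡⟨ ∑-comm (λ w u → ∑[ v < n ] χ (adj? u w ×-dec adj? v w)) ⟩
    ∑[ u < n ] ∑[ w < n ] ∑[ v < n ] χ (adj? u w ×-dec adj? v w)
      ≡⟨ sum-cong-≗ (λ u → ∑-comm (λ w v → χ (adj? u w ×-dec adj? v w))) ⟩
    ∑[ u < n ] ∑[ v < n ] codeg u v              ∎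
  -- The pair with `u = v` may have codegree `n`; it raises the bound on a row from `3n` to `4n`.
  codeg≤ : ∀ u v → codeg u v ≤ 3 + χ (u Fin.≟ v) * n
  codeg≤ u v with u Fin.≟ v
  ... | no u≢v = codeg≤3 u v u≢v
  ... | yes _  = begin
    codeg u v    ≤⟨ sum≤n*b 1 (λ w → χ≤1 (adj? u w ×-dec adj? v w)) ⟩
    n * 1        ≡⟨ *-comm n 1 ⟩
    1 * n        ≤⟨ m≤n+m (1 * n) 3 ⟩
    3 + 1 * n    ∎
  row≤ : ∀ u → ∑[ v < n ] codeg u v ≤ n * 4
  row≤ u = begin
    ∑[ v < n ] codeg u v                              ≤⟨ sum-mono-≤ (codeg≤ u) ⟩
    ∑[ v < n ] (3 + χ (u Fin.≟ v) * n)                ≡⟨ ∑-distrib-+ (λ _ → 3) (λ v → χ (u Fin.≟ v) * n) ⟩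
    ∑[ v < n ] 3 + ∑[ v < n ] (χ (u Fin.≟ v) * n)     ≡⟨ cong (∑[ v < n ] 3 +_) (*-distribʳ-sum n (λ v → χ (u Fin.≟ v))) ⟨
    ∑[ v < n ] 3 + (∑[ v < n ] χ (u Fin.≟ v)) * n     ≤⟨ +-mono-≤ (sum≤n*b {n} 3 (λ _ → ≤-refl)) (*-monoˡ-≤ n (∑χ≤1 (u Fin.≟_) (λ p q → trans (sym p) q))) ⟩
    n * 3 + 1 * n                                     ≡⟨ lemma n ⟩
    n * 4                                             ∎
    where
    lemma : ∀ n → n * 3 + 1 * n ≡ n * 4
    lemma = solve-∀

-- Rainbow houses from two rows with four common columns

P5? : ∀ u v → Dec (P5 u v)
P5? u v = (suc (toℕ u) ≟ toℕ v) ⊎-dec (suc (toℕ v) ≟ toℕ u)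

House? : ∀ u v → Dec (House u v)
House? u v = ¬? (u Fin.≟ v) ×-dec ¬? (P5? u v)

-- 0 3 1 4 is the square, and 2 is the roof over the edge 0 4.
houseEdge : Fin 6 → Fin 5 × Fin 5
houseEdge = lookup ((4F , 2F) ∷ (0F , 2F) ∷ (0F , 3F) ∷ (0F , 4F) ∷ (1F , 3F) ∷ (1F , 4F) ∷ [])

_≟₂_ : ∀ {n} (e f : Fin n × Fin n) → Dec (e ≡ f)
_≟₂_ = ≡-dec Fin._≟_ Fin._≟_

abstract
  House⇒houseEdge : ∀ u v → House u v → ∃ λ t → houseEdge t ≡ (u , v) ⊎ houseEdge t ≡ (v , u)
  House⇒houseEdge = toWitness {a? = Fin.all? λ u → Fin.all? λ v → House? u v →-dec
    Fin.any? λ t → (houseEdge t ≟₂ (u , v)) ⊎-dec (houseEdge t ≟₂ (v , u))} _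

  houseEdge-injective : ∀ s t → houseEdge s ≡ houseEdge t → s ≡ t
  houseEdge-injective = toWitness
    {a? = Fin.all? λ s → Fin.all? λ t → (houseEdge s ≟₂ houseEdge t) →-dec (s Fin.≟ t)} _

colEdge : ∀ {n} → EdgeColouring n → Fin n × Fin n → ℕ
colEdge c (x , y) = col c x y

-- Six edge representatives suffice, because the symmetry of `col` absorbs the orientation of an
-- edge.
rainbowHouse : ∀ {n} (c : EdgeColouring n) (φ : Fin 5 → Fin n) → Injective _≡_ _≡_ φ →
               Injective _≡_ _≡_ (colEdge c ∘ map φ φ ∘ houseEdge) → RainbowCopy House c
rainbowHouse c φ φ-inj col-inj = φ , φ-inj , λ u v u′ v′ h h′ eq →
  let s , hs = House⇒houseEdge u v h
      t , ht = House⇒houseEdge u′ v′ h′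
  in same s t hs ht eq
  where
  colour : ∀ t {u v} → houseEdge t ≡ (u , v) ⊎ houseEdge t ≡ (v , u) →
           colEdge c (map φ φ (houseEdge t)) ≡ col c (φ u) (φ v)
  colour t (inj₁ eq) = cong (colEdge c ∘ map φ φ) eq
  colour t (inj₂ eq) = trans (cong (colEdge c ∘ map φ φ) eq) (col-sym c _ _)
  unordered : ∀ {p} {u v u′ v′ : Fin 5} → p ≡ (u , v) ⊎ p ≡ (v , u) → p ≡ (u′ , v′) ⊎ p ≡ (v′ , u′) →
              (u ≡ u′ × v ≡ v′) ⊎ (u ≡ v′ × v ≡ u′)
  unordered (inj₁ refl) (inj₁ refl) = inj₁ (refl , refl)
  unordered (inj₁ refl) (inj₂ refl) = inj₂ (refl , refl)
  unordered (inj₂ refl) (inj₁ refl) = inj₂ (refl , refl)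
  unordered (inj₂ refl) (inj₂ refl) = inj₁ (refl , refl)
  same : ∀ s t {u v u′ v′} → houseEdge s ≡ (u , v) ⊎ houseEdge s ≡ (v , u) →
         houseEdge t ≡ (u′ , v′) ⊎ houseEdge t ≡ (v′ , u′) →
         col c (φ u) (φ v) ≡ col c (φ u′) (φ v′) → (u ≡ u′ × v ≡ v′) ⊎ (u ≡ v′ × v ≡ u′)
  same s t hs ht eq with refl ← col-inj {s} {t} (trans (colour s hs) (trans eq (sym (colour t ht)))) = unordered hs ht

module _ {m n} (c : EdgeColouring n) (e : Fin m → Fin n × Fin n)
         (proper : ∀ k → proj₁ (e k) ≢ proj₂ (e k)) (col-inj : Injective _≡_ _≡_ (colEdge c ∘ e)) where

  private
    -- Deliberately oriented: `u` is a row and `w` a column of the matrix of chosen edges.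
    Adj : Fin n → Fin n → Set
    Adj u w = ∃ λ k → e k ≡ (u , w)

    adj⇒≢ : ∀ {u w} → Adj u w → u ≢ w
    adj⇒≢ (k , refl) = proper k

    adj-col-injective : ∀ {u w u′ w′} → Adj u w → Adj u′ w′ → col c u w ≡ col c u′ w′ → (u , w) ≡ (u′ , w′)
    adj-col-injective (k , refl) (l , refl) eq = cong e (col-inj eq)

    module _ (b : Fin 4 → Fin n) (b-inj : Injective _≡_ _≡_ b) where

      -- The square is `x bⱼ y bᵢ`, and `bₖ` is the roof over the edge `x bᵢ`. All edges but `bᵢ bₖ`
      -- are chosen ones, hence differently coloured, so only the colour `X` of that edge has to be
      -- compared with the other five.
      house : ∀ {x y} → x ≢ y → (∀ j → Adj x (b j)) → (∀ j → Adj y (b j)) →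
              ∀ i j k → i ≢ j → i ≢ k → j ≢ k →
              let X = col c (b i) (b k) in
              X ≢ col c x (b k) → X ≢ col c x (b j) → X ≢ col c x (b i) → X ≢ col c y (b j) → X ≢ col c y (b i) →
              RainbowCopy House c
      house {x} {y} x≢y xb yb i j k i≢j i≢k j≢k ≢xk ≢xj ≢xi ≢yj ≢yi =
        rainbowHouse c φ φ-inj colours-inj
        where
        φ : Fin 5 → Fin n
        φ = lookup (x ∷ y ∷ b k ∷ b j ∷ b i ∷ [])
        φ-inj : Injective _≡_ _≡_ φ
        φ-inj = lookup-injective
          ( (x≢y ∷ adj⇒≢ (xb k) ∷ adj⇒≢ (xb j) ∷ adj⇒≢ (xb i) ∷ [])
          ∷ (adj⇒≢ (yb k) ∷ adj⇒≢ (yb j) ∷ adj⇒≢ (yb i) ∷ [])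
          ∷ (j≢k ∘ sym ∘ b-inj ∷ i≢k ∘ sym ∘ b-inj ∷ [])
          ∷ (i≢j ∘ sym ∘ b-inj ∷ [])
          ∷ [] ∷ []) _ _
        X = col c (b i) (b k)
        edge : Fin 6 → Fin n × Fin n
        edge = map φ φ ∘ houseEdge
        X≢ : ∀ t → X ≢ colEdge c (edge (suc t))
        X≢ 0F = ≢xk
        X≢ 1F = ≢xj
        X≢ 2F = ≢xi
        X≢ 3F = ≢yj
        X≢ 4F = ≢yi
        adj : ∀ t → Adj (proj₁ (edge (suc t))) (proj₂ (edge (suc t)))
        adj 0F = xb k
        adj 1F = xb j
        adj 2F = xb i
        adj 3F = yb j
        adj 4F = yb i
        edge-inj : ∀ {s t} → edge s ≡ edge t → s ≡ t
        edge-inj {s} {t} eq = houseEdge-injective s t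
          (cong₂ _,_ (φ-inj (cong proj₁ eq)) (φ-inj (cong proj₂ eq)))
        colours-inj : Injective _≡_ _≡_ (colEdge c ∘ edge)
        colours-inj {zero}  {zero}  _  = refl
        colours-inj {zero}  {suc t} eq = contradiction eq (X≢ t)
        colours-inj {suc s} {zero}  eq = contradiction (sym eq) (X≢ s)
        colours-inj {suc s} {suc t} eq = edge-inj (adj-col-injective (adj s) (adj t) eq)

      -- The edge b₀b₁ carries the colour of y bₗ: take the triangle at x, and square vertices bᵢ, bⱼ with i, j ≢ l.
      house-colour-of-y : ∀ {x y} → x ≢ y → (∀ j → Adj x (b j)) → (∀ j → Adj y (b j)) →
                          ∀ l → col c (b 0F) (b 1F) ≡ col c y (b l) → RainbowCopy House c
      house-colour-of-y {x} {y} x≢y xb yb = λ where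
          -- In every case `bᵢ bₖ` is the edge `b₀ b₁`. For `l = 0` it is read backwards, which
          -- makes `b₀` the roof and keeps it out of the square.
          0F eq → choose 0F 1F 2F 0F (λ ()) (λ ()) (λ ()) (λ ()) (λ ()) (trans (col-sym c _ _) eq)
          1F eq → choose 1F 0F 2F 1F (λ ()) (λ ()) (λ ()) (λ ()) (λ ()) eq
          2F eq → choose 2F 0F 3F 1F (λ ()) (λ ()) (λ ()) (λ ()) (λ ()) eq
          3F eq → choose 3F 0F 2F 1F (λ ()) (λ ()) (λ ()) (λ ()) (λ ()) eq
        where
        choose : ∀ l i j k → i ≢ j → i ≢ k → j ≢ k → l ≢ i → l ≢ j →
                 col c (b i) (b k) ≡ col c y (b l) → RainbowCopy House c
        choose l i j k i≢j i≢k j≢k l≢i l≢j eq =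
          house x≢y xb yb i j k i≢j i≢k j≢k (≢x k) (≢x j) (≢x i) (≢y l≢j) (≢y l≢i)
          where
          ≢x : ∀ h → col c (b i) (b k) ≢ col c x (b h)
          ≢x h eq′ = x≢y (sym (cong proj₁ (adj-col-injective (yb l) (xb h) (trans (sym eq) eq′))))
          ≢y : ∀ {h} → l ≢ h → col c (b i) (b k) ≢ col c y (b h)
          ≢y l≢h eq′ = l≢h (b-inj (cong proj₂ (adj-col-injective (yb l) (yb _) (trans (sym eq) eq′))))

      -- If `b₀ b₁` repeats a colour at `y`, the previous lemma applies; if it repeats one at `x`,
      -- the roles of `x` and `y` are exchanged; otherwise its colour is new and a fixed placement
      -- of the house works.
      K₂,₄⇒rainbowHouse : ∀ {x y} → x ≢ y → (∀ j → Adj x (b j)) → (∀ j → Adj y (b j)) → RainbowCopy House c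
      K₂,₄⇒rainbowHouse {x} {y} x≢y xb yb
        with Fin.any? (λ l → col c (b 0F) (b 1F) ≟ col c y (b l))
           | Fin.any? (λ l → col c (b 0F) (b 1F) ≟ col c x (b l))
      ... | yes (l , eq) | _            = house-colour-of-y x≢y xb yb l eq
      ... | no _         | yes (l , eq) = house-colour-of-y (x≢y ∘ sym) yb xb l eq
      ... | no ≢y        | no ≢x        =
        house x≢y xb yb 0F 2F 1F (λ ()) (λ ()) (λ ())
          (≢x ∘ (1F ,_)) (≢x ∘ (2F ,_)) (≢x ∘ (0F ,_)) (≢y ∘ (2F ,_)) (≢y ∘ (0F ,_))

  no-rainbowHouse⇒few-colours : ¬ RainbowCopy House c → m * m ≤ n * (n * (n * 4))
  no-rainbowHouse⇒few-colours ¬rainbow = few-common⇒few-edges e (col-inj ∘ cong (colEdge c)) λ u v u≢v →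
    ≮⇒≥ λ 4≤ →
      let b , b-inj , adj = distinct-witnesses _ 4 4≤
      in ¬rainbow (K₂,₄⇒rainbowHouse b b-inj u≢v (proj₁ ∘ adj) (proj₂ ∘ adj))

-- Decidability of Forces

-- Functions between finite sets are enumerated by their codes. A function agrees with its decoded
-- code only pointwise, so `P` has to respect `≗`.
∃-function? : ∀ {a b} {P : (Fin a → Fin b) → Set} → (∀ {f g} → f ≗ g → P f → P g) →
              (∀ f → Dec (P f)) → Dec (∃ P)
∃-function? resp P? = map′
  (λ (k , p) → finToFun k , p)
  (λ (f , p) → funToFin f , resp (sym ∘ Fin.finToFun-funToFin f) p)
  (Fin.any? (P? ∘ finToFun))

injective? : ∀ {m} {A : Set} → DecidableEquality A → (f : Fin m → A) → Dec (Injective _≡_ _≡_ f)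
injective? _≟ᴬ_ f = map′ (λ h {i} {j} → h i j) (λ h i j → h)
  (Fin.all? λ i → Fin.all? λ j → (f i ≟ᴬ f j) →-dec (i Fin.≟ j))

injective-resp-≗ : ∀ {A B : Set} {f g : A → B} → f ≗ g → Injective _≡_ _≡_ f → Injective _≡_ _≡_ g
injective-resp-≗ f≗g f-inj {x} {y} eq = f-inj (trans (f≗g x) (trans eq (sym (f≗g y))))

rainbowCopy? : ∀ {k n} {F : Graph k} → (∀ u v → Dec (F u v)) → (c : EdgeColouring n) → Dec (RainbowCopy F c)
rainbowCopy? {F = F} F? c = ∃-function?
  (λ φ≗ψ (inj , rainbow) → injective-resp-≗ φ≗ψ inj , λ u v u′ v′ h h′ eq →
    rainbow u v u′ v′ h h′ (trans (cong₂ (col c) (φ≗ψ u) (φ≗ψ v)) (trans eq (sym (cong₂ (col c) (φ≗ψ u′) (φ≗ψ v′))))))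
  (λ φ → injective? Fin._≟_ φ ×-dec
    Fin.all? λ u → Fin.all? λ v → Fin.all? λ u′ → Fin.all? λ v′ →
      F? u v →-dec (F? u′ v′ →-dec ((col c (φ u) (φ v) ≟ col c (φ u′) (φ v′)) →-dec
        (((u Fin.≟ u′) ×-dec (v Fin.≟ v′)) ⊎-dec ((u Fin.≟ v′) ×-dec (v Fin.≟ u′))))))

usesAtLeast? : ∀ {n} (c : EdgeColouring n) m → Dec (UsesAtLeast c m)
usesAtLeast? {n} c m = map′
  (λ (f , uses) → remQuot n ∘ f , uses)
  (λ (e , uses) → uncurry combine ∘ e , Uses-resp (λ k → sym (uncurry Fin.remQuot-combine (e k))) uses)
  (∃-function? (λ f≗g → Uses-resp (λ k → cong (remQuot n) (f≗g k))) λ f →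
    Fin.all? (λ k → ¬? (_ Fin.≟ _)) ×-dec injective? _≟_ _)
  where
  Uses : (Fin m → Fin n × Fin n) → Set
  Uses e = ((k : Fin m) → proj₁ (e k) ≢ proj₂ (e k)) ×
           Injective _≡_ _≡_ (λ k → col c (proj₁ (e k)) (proj₂ (e k)))
  Uses-resp : ∀ {e e′ : Fin m → Fin n × Fin n} → e ≗ e′ → Uses e → Uses e′
  Uses-resp e≗e′ (proper , inj) =
    (λ k → subst (λ p → proj₁ p ≢ proj₂ p) (e≗e′ k) (proper k)) ,
    injective-resp-≗ (λ k → cong (λ p → col c (proj₁ p) (proj₂ p)) (e≗e′ k)) inj

-- The least index with the same value: a canonical name for a colour class, taken from a finite
-- set.
firstOccurrence : ∀ {N} → (Fin N → ℕ) → Fin N → Fin N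
firstOccurrence f zero = zero
firstOccurrence f (suc i) with f zero ≟ f (suc i)
... | yes _ = zero
... | no  _ = suc (firstOccurrence (f ∘ suc) i)

f[firstOccurrence]≡f : ∀ {N} (f : Fin N → ℕ) i → f (firstOccurrence f i) ≡ f i
f[firstOccurrence]≡f f zero = refl
f[firstOccurrence]≡f f (suc i) with f zero ≟ f (suc i)
... | yes eq = eq
... | no  _  = f[firstOccurrence]≡f (f ∘ suc) i

firstOccurrence-cong : ∀ {N} (f : Fin N → ℕ) i j → f i ≡ f j → firstOccurrence f i ≡ firstOccurrence f j
firstOccurrence-cong f zero    zero    eq = refl
firstOccurrence-cong f zero    (suc j) eq with f zero ≟ f (suc j)
... | yes _ = refl
... | no ¬p = contradiction eq ¬p
firstOccurrence-cong f (suc i) zero    eq with f zero ≟ f (suc i)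
... | yes _ = refl
... | no ¬p = contradiction (sym eq) ¬p
firstOccurrence-cong f (suc i) (suc j) eq with f zero ≟ f (suc i) | f zero ≟ f (suc j)
... | yes _ | yes _ = refl
... | yes p | no ¬q = contradiction (trans p eq) ¬q
... | no ¬p | yes q = contradiction (trans q (sym eq)) ¬p
... | no _  | no _  = cong suc (firstOccurrence-cong (f ∘ suc) i j eq)

-- The colour classes of `c` refine those of `c′`. Both `UsesAtLeast` and `RainbowCopy` pass to
-- finer colourings.
_⊑_ : ∀ {n} → EdgeColouring n → EdgeColouring n → Set
c ⊑ c′ = ∀ i j k l → col c i j ≡ col c k l → col c′ i j ≡ col c′ k l

usesAtLeast-⊑ : ∀ {n m} {c c′ : EdgeColouring n} → c′ ⊑ c → UsesAtLeast c m → UsesAtLeast c′ m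
usesAtLeast-⊑ c′⊑c (e , proper , inj) = e , proper , inj ∘ c′⊑c _ _ _ _

rainbowCopy-⊑ : ∀ {k n} {F : Graph k} {c c′ : EdgeColouring n} → c′ ⊑ c → RainbowCopy F c → RainbowCopy F c′
rainbowCopy-⊑ c′⊑c (φ , inj , rainbow) = φ , inj , λ u v u′ v′ h h′ eq → rainbow u v u′ v′ h h′ (c′⊑c _ _ _ _ eq)

code : ∀ {n} → EdgeColouring n → Fin (n * n) → Fin (n * n)
code {n} c = firstOccurrence (uncurry (col c) ∘ remQuot n)

decode : ∀ {n} → (Fin (n * n) → Fin (n * n)) → Fin n → Fin n → ℕ
decode g i j = toℕ (g (combine i j))

module _ {n} (c : EdgeColouring n) where

  private
    f : Fin (n * n) → ℕ
    f = uncurry (col c) ∘ remQuot n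

    f-combine : ∀ i j → f (combine i j) ≡ col c i j
    f-combine i j = cong (uncurry (col c)) (Fin.remQuot-combine i j)

  decode-code-cong : ∀ {i j k l} → col c i j ≡ col c k l → decode (code c) i j ≡ decode (code c) k l
  decode-code-cong {i} {j} {k} {l} eq = cong toℕ (firstOccurrence-cong f (combine i j) (combine k l)
    (trans (f-combine i j) (trans eq (sym (f-combine k l)))))

  decode-code-injective : ∀ {i j k l} → decode (code c) i j ≡ decode (code c) k l → col c i j ≡ col c k l
  decode-code-injective {i} {j} {k} {l} eq = begin
    col c i j                      ≡⟨ f-combine i j ⟨
    f (combine i j)                ≡⟨ f[firstOccurrence]≡f f (combine i j) ⟨
    f (code c (combine i j))       ≡⟨ cong f (Fin.toℕ-injective eq) ⟩
    f (code c (combine k l))       ≡⟨ f[firstOccurrence]≡f f (combine k l) ⟩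
    f (combine k l)                ≡⟨ f-combine k l ⟩
    col c k l                      ∎
    where open ≡-Reasoning

-- Only the partition of the pairs into colour classes matters, so it suffices to search the colourings
-- whose colours are indices of pairs.
forces? : ∀ {k} {F : Graph k} → (∀ u v → Dec (F u v)) → ∀ n m → Dec (Forces F n m)
forces? {F = F} F? n m = map′ noBad⇒forces forces⇒noBad (¬? (∃-function? bad-resp bad?))
  where
  colouring : (g : Fin (n * n) → Fin (n * n)) → (∀ i j → decode {n} g i j ≡ decode g j i) → EdgeColouring n
  colouring g g-sym = record { col = decode g ; sym = g-sym }
  Bad : (Fin (n * n) → Fin (n * n)) → Set
  Bad g = Σ (∀ i j → decode {n} g i j ≡ decode g j i) λ g-sym →
          UsesAtLeast (colouring g g-sym) m × ¬ RainbowCopy F (colouring g g-sym)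
  bad? : ∀ g → Dec (Bad g)
  bad? g with Fin.all? (λ i → Fin.all? (λ j → decode {n} g i j ≟ decode g j i))
  ... | no ¬sym = no (¬sym ∘ proj₁)
  ... | yes g-sym = map′ (g-sym ,_) proj₂
    (usesAtLeast? (colouring g g-sym) m ×-dec ¬? (rainbowCopy? F? (colouring g g-sym)))
  bad-resp : ∀ {g h} → g ≗ h → Bad g → Bad h
  bad-resp {g} {h} g≗h (g-sym , uses , ¬rainbow) = h-sym ,
    usesAtLeast-⊑ {c = colouring g g-sym} {c′ = colouring h h-sym}
      (λ i j k l → subst₂ _≡_ (sym (pt i j)) (sym (pt k l))) uses ,
    ¬rainbow ∘ rainbowCopy-⊑ {c = colouring h h-sym} {c′ = colouring g g-sym}
      (λ i j k l → subst₂ _≡_ (pt i j) (pt k l))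
    where
    pt : ∀ i j → decode {n} g i j ≡ decode h i j
    pt i j = cong toℕ (g≗h (combine i j))
    h-sym : ∀ i j → decode {n} h i j ≡ decode h j i
    h-sym i j = subst₂ _≡_ (pt i j) (pt j i) (g-sym i j)
  -- `c` and its canonical form `code c` refine each other, so a counterexample `c` would yield a
  -- bad code.
  noBad⇒forces : ¬ ∃ Bad → Forces F n m
  noBad⇒forces ¬bad c uses = decidable-stable (rainbowCopy? F? c) λ ¬rainbow →
    ¬bad (code c , code-sym ,
      usesAtLeast-⊑ {c = c} {c′ = colouring (code c) code-sym} (λ _ _ _ _ → decode-code-injective c) uses ,
      ¬rainbow ∘ rainbowCopy-⊑ {c = colouring (code c) code-sym} {c′ = c} (λ _ _ _ _ → decode-code-cong c))
    where
    code-sym : ∀ i j → decode {n} (code c) i j ≡ decode (code c) j i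
    code-sym i j = decode-code-cong c (col-sym c i j)
  forces⇒noBad : Forces F n m → ¬ ∃ Bad
  forces⇒noBad forces (g , g-sym , uses , ¬rainbow) = ¬rainbow (forces (colouring g g-sym) uses)

least : ∀ {P : ℕ → Set} → Decidable P → ∀ b → P b → ∃ λ r → P r × (∀ m → P m → r ≤ m)
least {P} P? b pb = [ (λ found → found) , (λ none → contradiction pb (none b ≤-refl)) ]′ (search (suc b))
  where
  search : ∀ k → (∃ λ r → P r × (∀ m → P m → r ≤ m)) ⊎ (∀ m → m < k → ¬ P m)
  search zero = inj₂ λ m ()
  search (suc k) with search k | P? k
  ... | inj₁ found | _     = inj₁ found
  ... | inj₂ none  | yes p = inj₁ (k , p , λ m pm → ≮⇒≥ λ m<k → none m m<k pm)
  ... | inj₂ none  | no ¬p = inj₂ λ m m<1+k pm →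
    [ (λ m<k → none m m<k pm) , (λ m≡k → ¬p (subst P m≡k pm)) ]′ (m≤n⇒m<n∨m≡n (s≤s⁻¹ m<1+k))

-- The incidence colouring

module Bipartite {n} (I : Fin n → Fin n → Set) (I? : ∀ u v → Dec (I u v)) (side : Fin n → Bool)
                 (I⇒sides : ∀ {u v} → I u v → side u ≡ true × side v ≡ false) where

  private
    I-acyclic : ∀ {u v w} → I u v → ¬ I v w
    I-acyclic uv vw = contradiction (trans (sym (proj₂ (I⇒sides uv))) (proj₁ (I⇒sides vw))) λ ()

    -- Colour `0` is reserved for the pairs outside the graph. An edge gets the code of its pair in
    -- the orientation given by `I`, whichever way it is read.
    colour : Fin n → Fin n → ℕ
    colour u v with I? u v | I? v u
    ... | yes _ | _     = suc (toℕ (combine u v))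
    ... | no _  | yes _ = suc (toℕ (combine v u))
    ... | no _  | no _  = 0

    colour-sym : ∀ u v → colour u v ≡ colour v u
    colour-sym u v with I? u v | I? v u
    ... | yes uv | yes vu = contradiction vu (I-acyclic uv)
    ... | yes _  | no _   = refl
    ... | no _   | yes _  = refl
    ... | no _   | no _   = refl

    Adj : Fin n → Fin n → Set
    Adj u v = I u v ⊎ I v u

    colour-nonadj : ∀ {u v} → ¬ Adj u v → colour u v ≡ 0
    colour-nonadj {u} {v} ¬uv with I? u v | I? v u
    ... | yes uv | _      = contradiction (inj₁ uv) ¬uv
    ... | no _   | yes vu = contradiction (inj₂ vu) ¬uv
    ... | no _   | no _   = refl

    colour-I : ∀ {u v} → I u v → colour u v ≡ suc (toℕ (combine u v))
    colour-I {u} {v} uv with I? u v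
    ... | yes _  = refl
    ... | no ¬uv = contradiction uv ¬uv

    flip-side : ∀ {u v} → Adj u v → side u ≡ not (side v)
    flip-side (inj₁ uv) rewrite proj₁ (I⇒sides uv) | proj₂ (I⇒sides uv) = refl
    flip-side (inj₂ vu) rewrite proj₁ (I⇒sides vu) | proj₂ (I⇒sides vu) = refl

    no-triangle : ∀ {u v w} → Adj u v → Adj v w → ¬ Adj w u
    no-triangle {u} uv vw wu = odd (side u)
      (trans (flip-side uv) (cong not (trans (flip-side vw) (cong not (flip-side wu)))))
      where
      odd : ∀ b → b ≢ not (not (not b))
      odd true  ()
      odd false ()

    no-pentagon : ∀ {u v w x y} → Adj u v → Adj v w → Adj w x → Adj x y → ¬ Adj y u
    no-pentagon {u} uv vw wx xy yu = odd (side u)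
      (trans (flip-side uv) (cong not (trans (flip-side vw) (cong not (trans (flip-side wx)
        (cong not (trans (flip-side xy) (cong not (flip-side yu)))))))))
      where
      odd : ∀ b → b ≢ not (not (not (not (not b))))
      odd true  ()
      odd false ()

  colouring : EdgeColouring n
  colouring = record { col = colour ; sym = colour-sym }

  module _ (C₄-free : ∀ {u v w x} → I u w → I u x → I v w → I v x → u ≡ v ⊎ w ≡ x) where

    private
      -- The edges must be oriented from `u` and `v` to `w` and `x`, or all the other way; any other
      -- pattern contains two consecutive arrows, which `I-acyclic` excludes.
      no-square : ∀ {u v w x} → u ≢ v → w ≢ x → Adj u w → Adj w v → Adj v x → ¬ Adj x u
      no-square u≢v w≢x (inj₁ uw) (inj₁ wv) _ _ = I-acyclic uw wv
      no-square u≢v w≢x (inj₁ uw) (inj₂ vw) (inj₂ xv) _ = I-acyclic xv vw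
      no-square u≢v w≢x (inj₁ uw) (inj₂ vw) (inj₁ vx) (inj₁ xu) = I-acyclic vx xu
      no-square u≢v w≢x (inj₁ uw) (inj₂ vw) (inj₁ vx) (inj₂ ux) = [ u≢v , w≢x ]′ (C₄-free uw ux vw vx)
      no-square u≢v w≢x (inj₂ wu) (inj₂ vw) _ _ = I-acyclic vw wu
      no-square u≢v w≢x (inj₂ wu) (inj₁ wv) (inj₁ vx) _ = I-acyclic wv vx
      no-square u≢v w≢x (inj₂ wu) (inj₁ wv) (inj₂ xv) (inj₂ ux) = I-acyclic wu ux
      no-square u≢v w≢x (inj₂ wu) (inj₁ wv) (inj₂ xv) (inj₁ xu) = [ w≢x , u≢v ]′ (C₄-free wu wv xu xv)

    -- All edges of a rainbow house but at most one lie in the graph. Without the chord a pentagon remains;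
    -- with it, the square or the triangle survives.
    no-rainbowHouse : ¬ RainbowCopy House colouring
    no-rainbowHouse (φ , φ-inj , rainbow) = by-cases (adj? 0F 4F) (adj? 0F 2F) (adj? 2F 4F)
      where
      adj? : ∀ u v → Dec (Adj (φ u) (φ v))
      adj? u v = I? (φ u) (φ v) ⊎-dec I? (φ v) (φ u)
      same? : (u v u′ v′ : Fin 5) → Dec ((u ≡ u′ × v ≡ v′) ⊎ (u ≡ v′ × v ≡ u′))
      same? u v u′ v′ = ((u Fin.≟ u′) ×-dec (v Fin.≟ v′)) ⊎-dec ((u Fin.≟ v′) ×-dec (v Fin.≟ u′))
      -- Two house edges outside the graph would share colour `0`. The implicit checks on concrete
      -- vertices are settled by evaluation.
      other : ∀ u v {_ : True (House? u v)} → ¬ Adj (φ u) (φ v) →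
              ∀ u′ v′ {_ : True (House? u′ v′)} {_ : False (same? u v u′ v′)} → Adj (φ u′) (φ v′)
      other u v {h} ¬uv u′ v′ {h′} {differ} = decidable-stable (adj? u′ v′) λ ¬uv′ →
        toWitnessFalse differ (rainbow u v u′ v′ (toWitness h) (toWitness h′)
          (trans (colour-nonadj ¬uv) (sym (colour-nonadj ¬uv′))))
      0≢1 : φ 0F ≢ φ 1F
      0≢1 eq = contradiction (φ-inj eq) λ ()
      3≢4 : φ 3F ≢ φ 4F
      3≢4 eq = contradiction (φ-inj eq) λ ()
      by-cases : Dec (Adj (φ 0F) (φ 4F)) → Dec (Adj (φ 0F) (φ 2F)) → Dec (Adj (φ 2F) (φ 4F)) → ⊥
      by-cases (no ¬04) _ _ = no-pentagon
        (other 0F 4F ¬04 0F 3F) (other 0F 4F ¬04 3F 1F) (other 0F 4F ¬04 1F 4F)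
        (other 0F 4F ¬04 4F 2F) (other 0F 4F ¬04 2F 0F)
      by-cases (yes _) (no ¬02) _ = no-square 0≢1 3≢4
        (other 0F 2F ¬02 0F 3F) (other 0F 2F ¬02 3F 1F) (other 0F 2F ¬02 1F 4F) (other 0F 2F ¬02 4F 0F)
      by-cases (yes _) (yes _) (no ¬24) = no-square 0≢1 3≢4
        (other 2F 4F ¬24 0F 3F) (other 2F 4F ¬24 3F 1F) (other 2F 4F ¬24 1F 4F) (other 2F 4F ¬24 4F 0F)
      by-cases (yes e04) (yes e02) (yes e24) = no-triangle e02 e24 (Sum.swap e04)

    ¬forces-house : ∀ {m} (e : Fin m → Fin n × Fin n) → Injective _≡_ _≡_ e → (∀ k → uncurry I (e k)) →
                    ¬ Forces House n m
    ¬forces-house e e-inj e-I forces = no-rainbowHouse (forces colouring (e , proper , colours-inj))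
      where
      proper : ∀ k → proj₁ (e k) ≢ proj₂ (e k)
      proper k eq = I-acyclic (subst (I _) (sym eq) (e-I k)) (e-I k)
      colours-inj : Injective _≡_ _≡_ (λ k → colour (proj₁ (e k)) (proj₂ (e k)))
      colours-inj {k} {l} eq = e-inj (uncurry (cong₂ _,_) (Fin.combine-injective _ _ _ _
        (Fin.toℕ-injective (suc-injective (trans (sym (colour-I (e-I k))) (trans eq (colour-I (e-I l))))))))

-- Lines modulo a prime

[a+d]%p≡a%p⇒p∣d : ∀ {p} .{{_ : NonZero p}} a d → (a + d) % p ≡ a % p → p ∣ d
[a+d]%p≡a%p⇒p∣d {p} a d eq = ∣m+n∣m⇒∣n (divides ((a + d) / p) (+-cancelˡ-≡ (a % p) _ _ (begin
  a % p + (a / p * p + d)              ≡⟨ +-assoc (a % p) _ d ⟨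
  a % p + a / p * p + d                ≡⟨ cong (_+ d) (m≡m%n+[m/n]*n a p) ⟨
  a + d                                ≡⟨ m≡m%n+[m/n]*n (a + d) p ⟩
  (a + d) % p + (a + d) / p * p        ≡⟨ cong (_+ (a + d) / p * p) eq ⟩
  a % p + (a + d) / p * p              ∎))) (n∣m*n (a / p))
  where open ≡-Reasoning

%-cong-+ : ∀ {p} .{{_ : NonZero p}} {a a′ b b′} → a % p ≡ a′ % p → b % p ≡ b′ % p → (a + b) % p ≡ (a′ + b′) % p
%-cong-+ {p} {a} {a′} {b} {b′} a≡ b≡ = begin
  (a + b) % p              ≡⟨ %-distribˡ-+ a b p ⟩
  (a % p + b % p) % p      ≡⟨ cong₂ (λ x y → (x + y) % p) a≡ b≡ ⟩
  (a′ % p + b′ % p) % p    ≡⟨ %-distribˡ-+ a′ b′ p ⟨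
  (a′ + b′) % p            ∎
  where open ≡-Reasoning

p∣d<p⇒d≡0 : ∀ {p d} → d < p → p ∣ d → d ≡ 0
p∣d<p⇒d≡0 {d = zero}  _   _   = refl
p∣d<p⇒d≡0 {d = suc d} d<p p∣d = contradiction (∣⇒≤ p∣d) (<⇒≱ d<p)

[c+]%-injective : ∀ {p} .{{_ : NonZero p}} c {b b′} → b < p → b′ < p → (c + b) % p ≡ (c + b′) % p → b ≡ b′
[c+]%-injective {p} c {b} {b′} b<p b′<p eq =
  [ (λ b≤b′ → ordered b≤b′ b′<p eq) , (λ b′≤b → sym (ordered b′≤b b<p (sym eq))) ]′ (≤-total b b′)
  where
  ordered : ∀ {b b′} → b ≤ b′ → b′ < p → (c + b) % p ≡ (c + b′) % p → b ≡ b′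
  ordered {b} b≤b′ b′<p eq with d , refl ← m≤n⇒∃[o]m+o≡n b≤b′ = sym (trans (cong (b +_) d≡0) (+-identityʳ b))
    where
    d≡0 : d ≡ 0
    d≡0 = p∣d<p⇒d≡0 (≤-<-trans (m≤n+m d b) b′<p)
      ([a+d]%p≡a%p⇒p∣d (c + b) d (trans (cong (_% p) (+-assoc c b d)) (sym eq)))

-- The two sides differ by (m′ − m)(x′ − x).
rectangle-ordered : ∀ {p} .{{_ : NonZero p}} → Prime p → ∀ {m m′ x x′} c → m ≤ m′ → x ≤ x′ → m′ < p → x′ < p →
                    (m * x + m′ * x′ + c) % p ≡ (m′ * x + m * x′ + c) % p → m ≡ m′ ⊎ x ≡ x′
rectangle-ordered {p} pp {m} {x = x} c m≤m′ x≤x′ m′<p x′<p eq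
  with s , refl ← m≤n⇒∃[o]m+o≡n m≤m′ | t , refl ← m≤n⇒∃[o]m+o≡n x≤x′ =
  Sum.map (no-gap m′<p) (no-gap x′<p) (euclidsLemma s t pp
    ([a+d]%p≡a%p⇒p∣d ((m + s) * x + m * (x + t) + c) (s * t) (trans (cong (_% p) (lemma m s x t c)) eq)))
  where
  no-gap : ∀ {a d} → a + d < p → p ∣ d → a ≡ a + d
  no-gap {a} {d} a+d<p p∣d =
    sym (trans (cong (a +_) (p∣d<p⇒d≡0 (≤-<-trans (m≤n+m d a) a+d<p) p∣d)) (+-identityʳ a))
  lemma : ∀ m s x t c → (m + s) * x + m * (x + t) + c + s * t ≡ m * x + (m + s) * (x + t) + c
  lemma = solve-∀

-- Adding one congruence to the reverse of the other puts `b + b′` on both sides, which leaves a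
-- product of differences of slopes and abscissas divisible by `p`. Ordering both pairs avoids
-- subtraction.
two-common-points : ∀ {p} .{{_ : NonZero p}} → Prime p → ∀ m m′ x x′ b b′ →
                    m < p → m′ < p → x < p → x′ < p →
                    (m * x + b) % p ≡ (m′ * x + b′) % p → (m * x′ + b) % p ≡ (m′ * x′ + b′) % p →
                    m ≡ m′ ⊎ x ≡ x′
two-common-points {p} pp m m′ x x′ b b′ m<p m′<p x<p x′<p eq eq′ =
  [ (λ m≤m′ → steeper m m′ b b′ m≤m′ m′<p eq eq′)
  , (λ m′≤m → Sum.map₁ sym (steeper m′ m b′ b m′≤m m<p (sym eq) (sym eq′))) ]′ (≤-total m m′)
  where
  cross : ∀ m m′ x x′ b b′ → (m * x + b) % p ≡ (m′ * x + b′) % p → (m * x′ + b) % p ≡ (m′ * x′ + b′) % p →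
          (m * x + m′ * x′ + (b + b′)) % p ≡ (m′ * x + m * x′ + (b + b′)) % p
  cross m m′ x x′ b b′ eq eq′ = begin
    (m * x + m′ * x′ + (b + b′)) % p        ≡⟨ cong (_% p) (l₁ m m′ x x′ b b′) ⟩
    ((m * x + b) + (m′ * x′ + b′)) % p      ≡⟨ %-cong-+ {a = m * x + b} {m′ * x + b′} eq (sym eq′) ⟩
    ((m′ * x + b′) + (m * x′ + b)) % p      ≡⟨ cong (_% p) (l₂ m m′ x x′ b b′) ⟩
    (m′ * x + m * x′ + (b + b′)) % p        ∎
    where
    open ≡-Reasoning
    l₁ : ∀ m m′ x x′ b b′ → m * x + m′ * x′ + (b + b′) ≡ (m * x + b) + (m′ * x′ + b′)
    l₁ = solve-∀
    l₂ : ∀ m m′ x x′ b b′ → (m′ * x + b′) + (m * x′ + b) ≡ m′ * x + m * x′ + (b + b′)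
    l₂ = solve-∀
  steeper : ∀ m m′ b b′ → m ≤ m′ → m′ < p →
            (m * x + b) % p ≡ (m′ * x + b′) % p → (m * x′ + b) % p ≡ (m′ * x′ + b′) % p → m ≡ m′ ⊎ x ≡ x′
  steeper m m′ b b′ m≤m′ m′<p eq eq′ =
    [ (λ x≤x′ → rectangle-ordered pp (b + b′) m≤m′ x≤x′ m′<p x′<p (cross m m′ x x′ b b′ eq eq′))
    , (λ x′≤x → Sum.map₂ sym (rectangle-ordered pp (b + b′) m≤m′ x′≤x m′<p x<p (cross m m′ x′ x b b′ eq′ eq))) ]′
      (≤-total x x′)

-- Points (x , y) and lines y = m x + b of the affine plane over ℤ/p, together with k isolated vertices.
module Incidence {p} (pp : Prime p) (k : ℕ) where

  private
    instance
      p≢0 : NonZero p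
      p≢0 = prime⇒nonZero pp

    N = p * p + (p * p + k)

    Vertex : Set
    Vertex = Fin (p * p) ⊎ (Fin (p * p) ⊎ Fin k)

    view : Fin N → Vertex
    view v = Sum.map₂ (splitAt (p * p)) (splitAt (p * p) v)

    point line : Fin p × Fin p → Fin N
    point (x , y) = combine x y ↑ˡ (p * p + k)
    line (m , b)  = p * p ↑ʳ (combine m b ↑ˡ k)

    value : Fin p → Fin p → Fin p → ℕ
    value m x b = (toℕ m * toℕ x + toℕ b) % p

    On : Fin p × Fin p → Fin p × Fin p → Set
    On (x , y) (m , b) = toℕ y ≡ value m x b

    _∈_ : Vertex → Vertex → Set
    inj₁ i ∈ inj₂ (inj₁ j) = On (remQuot p i) (remQuot p j)
    _      ∈ _             = ⊥

    _∈?_ : ∀ s t → Dec (s ∈ t)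
    inj₁ i ∈? inj₂ (inj₁ j) = _ ≟ _
    inj₁ _ ∈? inj₁ _        = no λ ()
    inj₁ _ ∈? inj₂ (inj₂ _) = no λ ()
    inj₂ _ ∈? _             = no λ ()

    isPoint : Vertex → Bool
    isPoint (inj₁ _) = true
    isPoint (inj₂ _) = false

    I : Fin N → Fin N → Set
    I u v = view u ∈ view v

    I⇒sides : ∀ {u v} → I u v → isPoint (view u) ≡ true × isPoint (view v) ≡ false
    I⇒sides {u} {v} uv = sides (view u) (view v) uv
      where
      sides : ∀ s t → s ∈ t → isPoint s ≡ true × isPoint t ≡ false
      sides (inj₁ _) (inj₂ (inj₁ _)) _ = refl , refl

    view-injective : ∀ {u v} → view u ≡ view v → u ≡ v
    view-injective {u} {v} eq = splitAt-injective (p * p) (map₂-injective eq)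
      where
      splitAt-injective : ∀ m {n} {i j : Fin (m + n)} → splitAt m i ≡ splitAt m j → i ≡ j
      splitAt-injective m {n} {i} {j} eq =
        trans (sym (Fin.join-splitAt m n i)) (trans (cong (join m n) eq) (Fin.join-splitAt m n j))
      map₂-injective : ∀ {s t : Fin (p * p) ⊎ Fin (p * p + k)} →
                       Sum.map₂ (splitAt (p * p)) s ≡ Sum.map₂ (splitAt (p * p)) t → s ≡ t
      map₂-injective {inj₁ _} {inj₁ _} eq = cong inj₁ (inj₁-injective eq)
      map₂-injective {inj₂ _} {inj₂ _} eq = cong inj₂ (splitAt-injective (p * p) (inj₂-injective eq))

    -- Two lines with equal slopes and a common point coincide. Two points of one line with equal
    -- abscissas coincide, as no line is vertical.
    On-C₄-free : ∀ {P Q l l′} → On P l → On P l′ → On Q l → On Q l′ → P ≡ Q ⊎ l ≡ l′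
    On-C₄-free {x , y} {x′ , y′} {m , b} {m′ , b′} Pl Pl′ Ql Ql′ =
      [ (λ m≡m′ → inj₂ (same-line (Fin.toℕ-injective m≡m′))) , (λ x≡x′ → inj₁ (same-point (Fin.toℕ-injective x≡x′))) ]′
        (two-common-points pp (toℕ m) (toℕ m′) (toℕ x) (toℕ x′) (toℕ b) (toℕ b′)
          (Fin.toℕ<n m) (Fin.toℕ<n m′) (Fin.toℕ<n x) (Fin.toℕ<n x′) (trans (sym Pl) Pl′) (trans (sym Ql) Ql′))
      where
      same-line : m ≡ m′ → (m , b) ≡ (m′ , b′)
      same-line refl = cong (m ,_) (Fin.toℕ-injective
        ([c+]%-injective (toℕ m * toℕ x) (Fin.toℕ<n b) (Fin.toℕ<n b′) (trans (sym Pl) Pl′)))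
      same-point : x ≡ x′ → (x , y) ≡ (x′ , y′)
      same-point refl = cong (x ,_) (Fin.toℕ-injective (trans Pl (sym Ql)))

    I-C₄-free : ∀ {u v w x} → I u w → I u x → I v w → I v x → u ≡ v ⊎ w ≡ x
    I-C₄-free {u} {v} {w} {x} uw ux vw vx =
      Sum.map view-injective view-injective (∈-C₄-free (view u) (view v) (view w) (view x) uw ux vw vx)
      where
      remQuot-injective : ∀ {i j : Fin (p * p)} → remQuot p i ≡ remQuot p j → i ≡ j
      remQuot-injective {i} {j} eq =
        trans (sym (Fin.combine-remQuot {p} p i)) (trans (cong (uncurry combine) eq) (Fin.combine-remQuot {p} p j))
      ∈-C₄-free : ∀ s t y z → s ∈ y → s ∈ z → t ∈ y → t ∈ z → s ≡ t ⊎ y ≡ z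
      ∈-C₄-free (inj₁ _) (inj₁ _) (inj₂ (inj₁ _)) (inj₂ (inj₁ _)) sy sz ty tz =
        Sum.map (cong inj₁ ∘ remQuot-injective) (cong (inj₂ ∘ inj₁) ∘ remQuot-injective) (On-C₄-free sy sz ty tz)

    view-point : ∀ P → view (point P) ≡ inj₁ (uncurry combine P)
    view-point (x , y) = cong (Sum.map₂ (splitAt (p * p))) (Fin.splitAt-↑ˡ (p * p) (combine x y) (p * p + k))

    view-line : ∀ l → view (line l) ≡ inj₂ (inj₁ (uncurry combine l))
    view-line (m , b) = trans
      (cong (Sum.map₂ (splitAt (p * p))) (Fin.splitAt-↑ʳ (p * p) (p * p + k) (combine m b ↑ˡ k)))
      (cong inj₂ (Fin.splitAt-↑ˡ (p * p) (combine m b) k))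

    On⇒I : ∀ P l → On P l → I (point P) (line l)
    On⇒I P l on = subst₂ _∈_ (sym (view-point P)) (sym (view-line l))
      (subst₂ On (sym (uncurry Fin.remQuot-combine P)) (sym (uncurry Fin.remQuot-combine l)) on)

    -- The ordinate is computed from slope, abscissa and intercept, so incidences correspond to
    -- triples and number `p³`.
    flag : Fin p × Fin p × Fin p → Fin N × Fin N
    flag (m , x , b) = point (x , fromℕ< (m%n<n (toℕ m * toℕ x + toℕ b) p)) , line (m , b)

    flag-I : ∀ t → uncurry I (flag t)
    flag-I (m , x , b) = On⇒I _ (m , b) (Fin.toℕ-fromℕ< (m%n<n (toℕ m * toℕ x + toℕ b) p))

    flag-injective : Injective _≡_ _≡_ flag
    flag-injective {m , x , b} {m′ , x′ , b′} eq
      with refl , _ ← Fin.combine-injective x _ x′ _ (Fin.↑ˡ-injective (p * p + k) _ _ (cong proj₁ eq))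
         | refl , refl ← Fin.combine-injective m b m′ b′
             (Fin.↑ˡ-injective k _ _ (Fin.↑ʳ-injective (p * p) _ _ (cong proj₂ eq))) = refl

    triple : Fin (p * (p * p)) → Fin p × Fin p × Fin p
    triple i = map₂ (remQuot p) (remQuot (p * p) i)

    triple-injective : Injective _≡_ _≡_ triple
    triple-injective {i} {j} eq = begin
      i                          ≡⟨ untriple-triple i ⟨
      untriple (triple i)        ≡⟨ cong untriple eq ⟩
      untriple (triple j)        ≡⟨ untriple-triple j ⟩
      j                          ∎
      where
      open ≡-Reasoning
      untriple : Fin p × Fin p × Fin p → Fin (p * (p * p))
      untriple (m , x , b) = combine m (combine x b)
      untriple-triple : ∀ i → untriple (triple i) ≡ i
      untriple-triple i = trans (cong (combine {p} _) (Fin.combine-remQuot {p} p _)) (Fin.combine-remQuot {p} (p * p) i)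

  ¬forces-house : ¬ Forces House (p * p + (p * p + k)) (p * (p * p))
  ¬forces-house = Bipartite.¬forces-house I (λ u v → view u ∈? view v) (isPoint ∘ view)
    (λ {u} {v} → I⇒sides {u} {v}) (λ {u} {v} {w} {x} → I-C₄-free {u} {v} {w} {x})
    (flag ∘ triple) (triple-injective ∘ flag-injective) (flag-I ∘ triple)

-- The rainbow number of the house

forces-mono : ∀ {k n r m} {F : Graph k} → r ≤ m → Forces F n r → Forces F n m
forces-mono r≤m forces c (e , proper , inj) =
  forces c ((λ i → e (inject≤ i r≤m)) , (λ i → proper (inject≤ i r≤m)) ,
            λ eq → Fin.inject≤-injective r≤m r≤m _ _ (inj eq))

forces-house : ∀ n m → n * (n * (n * 4)) < m * m → Forces House n m
forces-house n m 4n³<m² c (e , proper , inj) = decidable-stable (rainbowCopy? House? c) λ ¬rainbow →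
  <⇒≱ 4n³<m² (no-rainbowHouse⇒few-colours c e proper inj ¬rainbow)

rainbowNumber-exists : ∀ n → ∃ (IsRainbowNumber House n)
rainbowNumber-exists n = least (forces? House? n) b (forces-house n b b<b*b)
  where
  b = suc (n * (n * (n * 4)))
  b<b*b : n * (n * (n * 4)) < b * b
  b<b*b = m≤m*n b b

-- By minimality `s = r − 1` does not force a house, so `s² ≤ 4n³`. Then
-- `(s + 1)² ≤ 2 (s² + 1) ≤ 2 (4n³ + n³)`.
rainbowNumber-upper : ∀ {n r} → 1 ≤ n → IsRainbowNumber House n r → r ^ 2 ≤ 10 * n ^ 3
rainbowNumber-upper {n} {zero}  1≤n _ = z≤n
rainbowNumber-upper {n} {suc s} 1≤n (_ , minimal) = begin
  suc s ^ 2                          ≡⟨ l₁ s ⟩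
  2 * (s * 1) + (s * s + 1)          ≤⟨ +-monoˡ-≤ _ (2xy≤x²+y² s 1) ⟩
  s * s + 1 + (s * s + 1)            ≤⟨ +-mono-≤ (+-mono-≤ s²≤ 1≤n³) (+-mono-≤ s²≤ 1≤n³) ⟩
  4n³ + n ^ 3 + (4n³ + n ^ 3)        ≡⟨ l₂ n ⟩
  10 * n ^ 3                         ∎
  where
  open ≤-Reasoning
  4n³ = n * (n * (n * 4))
  s²≤ : s * s ≤ 4n³
  s²≤ = ≮⇒≥ λ 4n³<s² → 1+n≰n (minimal s (forces-house n s 4n³<s²))
  1≤n³ : 1 ≤ n ^ 3
  1≤n³ = ^-monoˡ-≤ 3 1≤n
  l₁ : ∀ s → suc s * (suc s * 1) ≡ 2 * (s * 1) + (s * s + 1)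
  l₁ = solve-∀
  l₂ : ∀ n → let n³ = n * (n * (n * 1)); 4n³ = n * (n * (n * 4)) in 4n³ + n³ + (4n³ + n³) ≡ 10 * n³
  l₂ = solve-∀

-- The vertices beyond the `2p²` points and lines are isolated; forcing is monotone in the number of
-- colours.
p³≤rainbowNumber : ∀ {p n r} → Prime p → p * p + p * p ≤ n → IsRainbowNumber House n r → p * (p * p) ≤ r
p³≤rainbowNumber {p} {r = r} pp 2p²≤n (forces , _) with k , refl ← m≤n⇒∃[o]m+o≡n 2p²≤n =
  <⇒≤ (≰⇒> λ r≤p³ → Incidence.¬forces-house pp k
    (subst (λ n → Forces House n (p * (p * p))) (+-assoc (p * p) (p * p) k) (forces-mono r≤p³ forces)))

-- A prime of order √n and the final bounds

power-scale : ∀ b n → 1 < b → 0 < n → ∃ λ j → b ^ j ≤ n × n < b ^ suc j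
power-scale b n 1<b 0<n = climb n 0 0<n (≤-trans (n<b^n n) (≤-reflexive (cong (b ^_) (sym (+-identityʳ n)))))
  where
  n<b^n : ∀ n → n < b ^ n
  n<b^n zero = z<s
  n<b^n (suc n) = ≤-<-trans (n<b^n n) (^-monoʳ-< b 1<b (n<1+n n))
  -- `d` bounds the remaining steps; starting with `d = n` is enough since `n < b ^ n`.
  climb : ∀ d j → b ^ j ≤ n → n < b ^ (d + j) → ∃ λ j → b ^ j ≤ n × n < b ^ suc j
  climb zero    j b^j≤n n<b^j = contradiction b^j≤n (<⇒≱ n<b^j)
  climb (suc d) j b^j≤n n<    with n <? b ^ suc j
  ... | yes n<b^1+j = j , b^j≤n , n<b^1+j
  ... | no  n≮b^1+j = climb d (suc j) (≮⇒≥ n≮b^1+j) (subst (λ a → n < b ^ a) (sym (+-suc d j)) n<)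

-- Abstract, because unfolding the powers of the numeral 16 makes conversion checking slow.
abstract
  q : ℕ
  q = 16

  q≡16 : q ≡ 16
  q≡16 = refl

q>1 : 1 < q
q>1 = subst (1 <_) (sym q≡16) (s≤s (s≤s z≤n))

instance
  q≢0 : NonZero q
  q≢0 = >-nonZero (<-trans z<s q>1)

q^n≡2^n⁴ : ∀ n → q ^ n ≡ (2 ^ n * 2 ^ n) * (2 ^ n * 2 ^ n)
q^n≡2^n⁴ zero = refl
q^n≡2^n⁴ (suc n) = trans (cong₂ _*_ q≡16 (q^n≡2^n⁴ n)) (lemma (2 ^ n))
  where
  lemma : ∀ y → 16 * ((y * y) * (y * y)) ≡ ((2 * y) * (2 * y)) * ((2 * y) * (2 * y))
  lemma = solve-∀

-- For `q ^ (7 + j) ≤ n < q ^ (8 + j)`, take `p` from `prime-between j`. Then `p²` lies between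
-- `h⁴ = q ^ (4 + j)` and `M⁴ = q ^ (6 + j)`: one factor `q` is left to absorb the 2 in `2p²`, and
-- four factors are lost below.
prime-near-√n : ∀ n → q ^ 7 ≤ n → ∃ λ p → Prime p × p * p + p * p ≤ n × n ≤ q ^ 4 * (p * p)
prime-near-√n n q^7≤n with e , q^e≤n , n<q^1+e ← power-scale q n q>1 (<-≤-trans (m^n>0 q 7) q^7≤n)
  with j , refl ← m≤n⇒∃[o]m+o≡n {7} {e} (≮⇒≥ λ e<7 → <⇒≱ n<q^1+e (≤-trans (^-monoʳ-≤ q e<7) q^7≤n))
  with p , pp , h²<p , p≤M² ← prime-between j = p , pp , 2p²≤n , n≤
  where
  open ≤-Reasoning
  h = 2 ^ (4 + j)
  M = 2 ^ (6 + j)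
  h*h≤p : h * h ≤ p
  h*h≤p = subst (_≤ p) (trans (cong (λ a → 2 ^ (4 + j + a)) (+-identityʳ (4 + j))) (^-distribˡ-+-* 2 (4 + j) (4 + j))) (<⇒≤ h²<p)
  2p²≤n : p * p + p * p ≤ n
  2p²≤n = begin
    p * p + p * p               ≤⟨ +-mono-≤ (*-mono-≤ p≤M² p≤M²) (*-mono-≤ p≤M² p≤M²) ⟩
    y + y                       ≡⟨ cong (y +_) (+-identityʳ y) ⟨
    2 * y                       ≤⟨ *-monoˡ-≤ y (m≤m+n 2 14) ⟩
    16 * y                      ≡⟨ cong₂ _*_ q≡16 (q^n≡2^n⁴ (6 + j)) ⟨
    q ^ (7 + j)                ≤⟨ q^e≤n ⟩
    n                           ∎
    where
    y = M * M * (M * M)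
  n≤ : n ≤ q ^ 4 * (p * p)
  n≤ = begin
    n                           ≤⟨ <⇒≤ n<q^1+e ⟩
    q ^ (4 + (4 + j))          ≡⟨ ^-distribˡ-+-* q 4 (4 + j) ⟩
    q ^ 4 * q ^ (4 + j)       ≡⟨ cong (q ^ 4 *_) (q^n≡2^n⁴ (4 + j)) ⟩
    q ^ 4 * (h * h * (h * h))  ≤⟨ *-monoʳ-≤ (q ^ 4) (*-mono-≤ h*h≤p h*h≤p) ⟩
    q ^ 4 * (p * p)            ∎

-- Cubing `n ≤ q ^ 4 * p²` turns `p⁶` into the square of `p³`, which is at most `r ^ 2`.
rainbowNumber-lower : ∀ {n r} → q ^ 7 ≤ n → IsRainbowNumber House n r → n ^ 3 ≤ (q ^ 4) ^ 3 * r ^ 2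
rainbowNumber-lower {n} {r} q^7≤n rb = bound (prime-near-√n n q^7≤n)
  where
  open ≤-Reasoning
  l₁ : ∀ K s → K * s * (K * s * (K * s * 1)) ≡ K * (K * (K * 1)) * (s * (s * (s * 1)))
  l₁ = solve-∀
  l₂ : ∀ p → p * p * (p * p * (p * p * 1)) ≡ p * (p * p) * (p * (p * p) * 1)
  l₂ = solve-∀
  bound : (∃ λ p → Prime p × p * p + p * p ≤ n × n ≤ q ^ 4 * (p * p)) → n ^ 3 ≤ (q ^ 4) ^ 3 * r ^ 2
  bound (p , pp , 2p²≤n , n≤) = begin
    n ^ 3                             ≤⟨ ^-monoˡ-≤ 3 n≤ ⟩
    (q ^ 4 * (p * p)) ^ 3             ≡⟨ l₁ (q ^ 4) (p * p) ⟩
    (q ^ 4) ^ 3 * (p * p) ^ 3         ≡⟨ cong ((q ^ 4) ^ 3 *_) (l₂ p) ⟩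
    (q ^ 4) ^ 3 * (p * (p * p)) ^ 2   ≤⟨ *-monoʳ-≤ ((q ^ 4) ^ 3) (^-monoˡ-≤ 2 (p³≤rainbowNumber pp 2p²≤n rb)) ⟩
    (q ^ 4) ^ 3 * r ^ 2               ∎

theorem13 : Σ ℕ λ a → Σ ℕ λ b → Σ ℕ λ N →
    (n : ℕ) → N ≤ n →
    Σ ℕ λ r → IsRainbowNumber House n r ×
    (n ^ 3 ≤ suc a * r ^ 2) × (r ^ 2 ≤ suc b * n ^ 3)
-- The constants enter the bounds as successors: `9` stands for the factor 10, and the lower bound
-- gains one unit of slack.
theorem13 = (q ^ 4) ^ 3 , 9 , q ^ 7 , λ n N≤n → Θ-bounds n N≤n (rainbowNumber-exists n)
  where
  Θ-bounds : ∀ n → q ^ 7 ≤ n → ∃ (IsRainbowNumber House n) →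
             Σ ℕ λ r → IsRainbowNumber House n r × (n ^ 3 ≤ suc ((q ^ 4) ^ 3) * r ^ 2) × (r ^ 2 ≤ 10 * n ^ 3)
  Θ-bounds n N≤n (r , rb) = r , rb ,
    ≤-trans (rainbowNumber-lower N≤n rb) (*-monoˡ-≤ (r ^ 2) (n≤1+n ((q ^ 4) ^ 3))) ,
    rainbowNumber-upper (≤-trans (m^n>0 q 7) N≤n) rb
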